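{- Let $X,Y$ be connected graphs with $X\neq P_3$ and $Y\neq P_3$. Then there exists a constant $C_{XY}$ such that every connected $(X,Y)$-free graph $G$ (of order at least $3$) satisfies $rx_3(G)\leq sdiam_3(G)+C_{XY}$ if and only if, up to swapping $X$ and $Y$, $X=K_{1,r}$ for some $r\geq 3$ and $Y=P_4$.
   Context: All graphs are finite, simple, undirected. An edge-coloring of $G$ assigns colors to edges (adjacent edges may share a color). A tree in an edge-colored graph is rainbow if no two of its edges have the same color. For $S\subseteq V(G)$, an $S$-tree is a tree in $G$ containing all vertices of $S$. A $k$-rainbow coloring of a connected graph $G$ is an edge-coloring such that for every set $S$ of $k$ vertices there is a rainbow $S$-tree; $rx_k(G)$ is the minimum number of colors in a $k$-rainbow coloring of $G$. The Steiner distance $d(S)$ is the minimum number of edges of an $S$-tree; $sdiam_k(G)$ is the maximum of $d(S)$ over all $k$-element $S\subseteq V(G)$. $G$ is $(X,Y)$-free if it has no induced subgraph isomorphic to $X$ or to $Y$. $P_n$ is the path on $n$ vertices, $K_{1,r}$ the star with $r$ leaves.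
   Formalization: X and Y are additionally assumed to have order at least 3, i.e. not K_1 or K_2; for those no connected (X,Y)-free graph of order at least 3 exists, so a constant exists vacuously and the "only if" part fails (e.g. X = K_2, Y = K_3). -}

module Defs where

open import Data.Empty using (⊥)
open import Data.Fin using (Fin; zero; suc; toℕ; inject₁; fromℕ; _<?_)
open import Data.Fin.Subset using (Subset; _∈_; ∣_∣)
open import Data.List using (length; filter; cartesianProduct; allFin)
open import Data.Nat using (ℕ; suc; _≤_; _≟_)
open import Data.Nat.Properties using (1+n≢n)
open import Data.Product using (Σ-syntax; ∃-syntax; _×_; _,_; proj₁; proj₂)
open import Data.Sum using (_⊎_; inj₁; inj₂; swap; [_,_])
open import Data.Unit using (⊤; tt)
open import Function.Base using (_∘_)
open import Function.Bundles using (_↔_; _⇔_; Inverse)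
open import Function.Definitions using (Injective)
open import Level using (0ℓ)
open import Relation.Binary using (Rel; Decidable; Symmetric)
open import Relation.Binary.Construct.Closure.ReflexiveTransitive using (Star)
open import Relation.Binary.PropositionalEquality using (_≡_; sym)
open import Relation.Nullary using (¬_; yes; no)
open import Relation.Nullary.Decidable using (_×-dec_; _⊎-dec_)

record Graph : Set₁ where
  field
    order  : ℕ
    Adj    : Rel (Fin order) 0ℓ
    adj?   : Decidable Adj
    symm   : Symmetric Adj
    irrefl : ∀ {v} → ¬ Adj v v

  Vertex : Set
  Vertex = Fin order

  -- Number of edges, each counted once, as the pair (u , v) with u < v.
  size : ℕ
  size = length (filter (λ e → (proj₁ e <? proj₂ e) ×-dec adj? (proj₁ e) (proj₂ e))
                        (cartesianProduct (allFin order) (allFin order)))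

open Graph public using (Vertex; order; size)

Connected : Graph → Set
Connected G = 1 ≤ order G × (∀ u v → Star (Graph.Adj G) u v)

-- A cycle of length 3 + k, given by its vertices in cyclic order.
record Cycle (G : Graph) (k : ℕ) : Set where
  open Graph G using (Adj)
  field
    vertex    : Fin (suc (suc (suc k))) → Vertex G
    injective : Injective _≡_ _≡_ vertex
    step      : (i : Fin (suc (suc k))) → Adj (vertex (inject₁ i)) (vertex (suc i))
    close     : Adj (vertex (fromℕ (suc (suc k)))) (vertex zero)

Acyclic : Graph → Set
Acyclic G = ∀ k → ¬ Cycle G k

IsTree : Graph → Set
IsTree T = Connected T × Acyclic T

-- H as a (not necessarily induced) subgraph of G.
record Embedding (H G : Graph) : Set where
  field
    map       : Vertex H → Vertex G
    injective : Injective _≡_ _≡_ map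
    preserves : ∀ {u v} → Graph.Adj H u v → Graph.Adj G (map u) (map v)

record InducedEmbedding (H G : Graph) : Set where
  field
    map       : Vertex H → Vertex G
    injective : Injective _≡_ _≡_ map
    induced   : ∀ u v → Graph.Adj H u v ⇔ Graph.Adj G (map u) (map v)

infix 4 _≅_

record _≅_ (G H : Graph) : Set where
  field
    bijection : Vertex G ↔ Vertex H
    adjacency : ∀ u v → Graph.Adj G u v
                  ⇔ Graph.Adj H (Inverse.to bijection u) (Inverse.to bijection v)

Free : Graph → Graph → Set
Free X G = ¬ InducedEmbedding X G

PairFree : Graph → Graph → Graph → Set
PairFree X Y G = Free X G × Free Y G

-- Pₙ, with n vertices.
Path : ℕ → Graph
Path n = record
  { order  = n
  ; Adj    = λ i j → (toℕ j ≡ suc (toℕ i)) ⊎ (toℕ i ≡ suc (toℕ j))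
  ; adj?   = λ i j → (toℕ j ≟ suc (toℕ i)) ⊎-dec (toℕ i ≟ suc (toℕ j))
  ; symm   = swap
  ; irrefl = [ 1+n≢n ∘ sym , 1+n≢n ∘ sym ]
  }

StarAdj : ∀ {r} → Rel (Fin (suc r)) 0ℓ
StarAdj zero    zero    = ⊥
StarAdj zero    (suc _) = ⊤
StarAdj (suc _) zero    = ⊤
StarAdj (suc _) (suc _) = ⊥

starAdj? : ∀ {r} → Decidable (StarAdj {r})
starAdj? zero    zero    = no λ ()
starAdj? zero    (suc _) = yes tt
starAdj? (suc _) zero    = yes tt
starAdj? (suc _) (suc _) = no λ ()

starAdj-sym : ∀ {r} → Symmetric (StarAdj {r})
starAdj-sym {x = zero}  {suc _} _ = tt
starAdj-sym {x = suc _} {zero}  _ = tt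

starAdj-irrefl : ∀ {r} {v : Fin (suc r)} → ¬ StarAdj v v
starAdj-irrefl {v = zero}  ()
starAdj-irrefl {v = suc _} ()

-- K₁,ᵣ, with centre zero and r leaves.
StarGraph : ℕ → Graph
StarGraph r = record
  { order  = suc r
  ; Adj    = StarAdj
  ; adj?   = starAdj?
  ; symm   = λ {u} {v} → starAdj-sym {x = u} {v}
  ; irrefl = λ {v} → starAdj-irrefl {v = v}
  }

record STree (G : Graph) (S : Subset (order G)) : Set₁ where
  field
    tree      : Graph
    isTree    : IsTree tree
    embedding : Embedding tree G

  open Embedding embedding public

  field
    covers    : ∀ {v} → v ∈ S → ∃[ t ] map t ≡ v

-- A colouring with palette Fin m.  By `unoriented` the colour depends neither
-- on the orientation of the edge nor on the proof of adjacency.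
record EdgeColoring (G : Graph) (m : ℕ) : Set where
  open Graph G using (Adj)
  field
    color      : ∀ {u v} → Adj u v → Fin m
    unoriented : ∀ {u v} (p : Adj u v) (q : Adj v u) → color p ≡ color q

IsRainbow : ∀ {G m S} → EdgeColoring G m → STree G S → Set
IsRainbow c T = ∀ {a b a′ b′} (p : Adj a b) (q : Adj a′ b′) →
    color (preserves p) ≡ color (preserves q) →
    (a ≡ a′ × b ≡ b′) ⊎ (a ≡ b′ × b ≡ a′)
  where
    open EdgeColoring c using (color)
    open STree T using (tree; preserves)
    open Graph tree using (Adj)

IsRainbowColoring : ∀ {G m} → ℕ → EdgeColoring G m → Set₁
IsRainbowColoring {G} k c =
  (S : Subset (order G)) → ∣ S ∣ ≡ k → Σ[ T ∈ STree G S ] IsRainbow c T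

IsMinimum IsMaximum : ∀ {ℓ} → (ℕ → Set ℓ) → ℕ → Set ℓ
IsMinimum P m = P m × (∀ i → P i → m ≤ i)
IsMaximum P m = P m × (∀ i → P i → i ≤ m)

-- m = rxₖ(G).  Unused colours of the palette do not affect the minimum.
IsRainbowIndex : ℕ → Graph → ℕ → Set₁
IsRainbowIndex k G =
  IsMinimum (λ m → Σ[ c ∈ EdgeColoring G m ] IsRainbowColoring k c)

-- d = d(S).
IsSteinerDistance : (G : Graph) → Subset (order G) → ℕ → Set₁
IsSteinerDistance G S = IsMinimum (λ d → Σ[ T ∈ STree G S ] size (STree.tree T) ≡ d)

-- d = sdiamₖ(G).
IsSteinerDiameter : ℕ → Graph → ℕ → Set₁
IsSteinerDiameter k G =
  IsMaximum (λ d → Σ[ S ∈ Subset (order G) ] (∣ S ∣ ≡ k × IsSteinerDistance G S d))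

{-# OPTIONS --safe #-}
-- Necessity.  Stars K₁,ₜ and cliques Kₜ with a pendant edge at every vertex have bounded sdiam₃,
-- but any two pendant edges lie in a common rainbow tree, so rx₃ ≥ t.  On the cycle Cₙ one has rx₃
-- ≥ n − 2 and sdiam₃ ≤ 3n/4 + O(1): a tree through three vertices misses edges of at most one of
-- the three arcs, and a colouring with at least three repeated colours admits three vertices such
-- that no two of the arcs are jointly rainbow.  Stars force X (say) to be a star; the other two
-- families are claw-free, so Y embeds in both; being triangle-free and a subgraph of the second
-- family, it is P₃ or P₄.
--
-- Sufficiency.  In a connected P₄-free graph every nonempty independent set has a common neighbour,
-- so excluding K₁,ᵣ bounds independent sets by r.  Take three successive disjoint maximal
-- independent sets, join them to a hub by paths of length ≤ 2, colour the edges inside this bounded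
-- core differently, and give an edge from an outside vertex to the i-th set colour i.  Every
-- outside vertex has a neighbour in each set, so three vertices can enter the core through
-- different colours.
module Submission where

open import Data.Empty using (⊥; ⊥-elim)
open import Data.Fin as F using (Fin; zero; suc; toℕ; inject₁; fromℕ; fromℕ<; inject≤; punchIn;
  punchOut; combine; remQuot)
open import Data.Fin.Patterns using (0F; 1F; 2F; 3F)
open import Data.Fin.Properties as FP using (any?; all?; toℕ-injective; toℕ<n; toℕ-fromℕ;
  toℕ-fromℕ<; toℕ-inject₁; pigeonhole; injective⇒≤; punchInᵢ≢i; punchIn-injective; punchIn-punchOut;
  punchIn-mono-≤; combine-injective; combine-monoˡ-<; inject≤-injective)
open import Data.Fin.Relation.Unary.Top using (view; ‵fromℕ; ‵inject₁)
open import Data.Fin.Subset using (Subset; _∈_; _∉_; ∣_∣; _∪_; ⁅_⁆; inside; outside)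
  renaming (⊥ to ∅)
open import Data.Fin.Subset.Properties using (∣⊥∣≡0; ∪-identityʳ; x∈p∪q⁺; x∈p∪q⁻; x∈⁅x⁆; x∈⁅y⁆⇒x≡y;
  ∉⊥)
open import Data.List as List using (List; []; _∷_; _++_; length; lookup; filter; cartesianProduct;
  allFin)
import Data.List.Membership.DecPropositional as DecMembership
open import Data.List.Membership.Propositional using (find; lose)
  renaming (_∈_ to _∈ˡ_; _∉_ to _∉ˡ_)
open import Data.List.Membership.Propositional.Properties using (∈-lookup; ∈-++⁺ˡ; ∈-++⁺ʳ; ∈-++⁻;
  ∈-map⁺; ∈-map⁻; ∈-allFin)
open import Data.List.Properties using (length-++; length-map)
open import Data.List.Relation.Unary.All as All using (All; []; _∷_)
open import Data.List.Relation.Unary.All.Properties using (all-filter)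
open import Data.List.Relation.Unary.AllPairs using (AllPairs; []; _∷_)
open import Data.List.Relation.Unary.Any as Any using (here; there)
open import Data.List.Relation.Unary.Any.Properties using (lookup-index)
open import Data.List.Relation.Unary.Unique.Propositional using (Unique)
import Data.List.Relation.Unary.Unique.Propositional.Properties as Unique
open import Data.Nat using (ℕ; zero; suc; _+_; _*_; _∸_; _≤_; _<_; z≤n; s≤s; z<s; s<s)
open import Data.Nat.Properties as ℕP using (≤-refl; ≤-trans; ≤-reflexive; <-irrefl; <-trans;
  <-≤-trans; ≤-<-trans; <⇒≤; ≰⇒>; ≮⇒≥; m≤n+m)
open import Data.Product using (Σ-syntax; ∃-syntax; ∃; _×_; _,_; proj₁; proj₂)
open import Data.Sum using (_⊎_; inj₁; inj₂; [_,_])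
open import Data.Unit using (⊤; tt)
open import Data.Vec as Vec using (Vec; []; _∷_)
open import Data.Vec.Properties using (lookup∘tabulate)
open import Function.Base using (_∘_; id; _on_; case_of_)
open import Function.Bundles using (_⇔_; Equivalence; Inverse; mk⇔; mk↔ₛ′)
open import Function.Definitions using (Injective)
open import Level using (0ℓ)
open import Relation.Binary using (Rel; Decidable; Symmetric; tri<; tri≈; tri>)
open import Relation.Binary.Construct.Closure.ReflexiveTransitive using (Star; ε; _◅_; _◅◅_; gmap;
  reverse)
open import Relation.Binary.PropositionalEquality using (_≡_; _≢_; refl; sym; trans; cong; cong₂;
  subst; subst₂; ≢-sym)
open import Relation.Nullary using (¬_; Dec; yes; no; contradiction)
open import Relation.Nullary.Decidable using (map′; _×-dec_; _⊎-dec_; _→-dec_; ¬?)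
open import Defs

private
  variable
    n m k : ℕ

-- Finite subsets and their enumerations

elements : (S : Subset n) → ∣ S ∣ ≡ k →
  Σ[ s ∈ (Fin k → Fin n) ] (∀ {v} → v ∈ S → ∃[ i ] s i ≡ v)
elements [] refl = (λ ()) , λ ()
elements (outside ∷ S) refl =
  let s , onto = elements S refl in
  suc ∘ s , λ { (Vec.there v∈S) → let i , eq = onto v∈S in i , cong suc eq }
elements (inside ∷ S) refl =
  let s , onto = elements S refl in
  (λ { zero → zero ; (suc i) → suc (s i) }) ,
  λ { Vec.here → zero , refl
    ; (Vec.there v∈S) → let i , eq = onto v∈S in suc i , cong suc eq }

∣p∪⁅x⁆∣≡1+∣p∣ : (p : Subset n) (x : Fin n) → x ∉ p → ∣ p ∪ ⁅ x ⁆ ∣ ≡ suc ∣ p ∣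
∣p∪⁅x⁆∣≡1+∣p∣ (inside  ∷ p) zero    x∉p = contradiction Vec.here x∉p
∣p∪⁅x⁆∣≡1+∣p∣ (outside ∷ p) zero    x∉p = cong (suc ∘ ∣_∣) (∪-identityʳ p)
∣p∪⁅x⁆∣≡1+∣p∣ (inside  ∷ p) (suc x) x∉p = cong suc (∣p∪⁅x⁆∣≡1+∣p∣ p x (x∉p ∘ Vec.there))
∣p∪⁅x⁆∣≡1+∣p∣ (outside ∷ p) (suc x) x∉p = ∣p∪⁅x⁆∣≡1+∣p∣ p x (x∉p ∘ Vec.there)

image : (s : Fin k → Fin n) → Injective _≡_ _≡_ s →
  Σ[ S ∈ Subset n ] (∣ S ∣ ≡ k × (∀ i → s i ∈ S) × (∀ {v} → v ∈ S → ∃[ i ] s i ≡ v))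
image {zero} {n} s inj = ∅ , ∣⊥∣≡0 n , (λ ()) , λ v∈∅ → contradiction v∈∅ ∉⊥
image {suc k} s inj with image (s ∘ suc) (FP.suc-injective ∘ inj)
... | S , size , into , onto =
  S ∪ ⁅ s zero ⁆ ,
  trans (∣p∪⁅x⁆∣≡1+∣p∣ S (s zero) fresh) (cong suc size) ,
  (λ { zero → x∈p∪q⁺ (inj₂ (x∈⁅x⁆ (s zero))) ; (suc i) → x∈p∪q⁺ (inj₁ (into i)) }) ,
  λ v∈ → [ (λ v∈S → let i , eq = onto v∈S in suc i , eq)
         , (λ v∈x → zero , sym (x∈⁅y⁆⇒x≡y (s zero) v∈x)) ] (x∈p∪q⁻ S ⁅ s zero ⁆ v∈)
  where
  fresh : s zero ∉ S
  fresh x∈S with onto x∈S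
  ... | i , eq with inj eq
  ...   | ()

-- Trees grown by attaching leaves

data Growth : ℕ → Set where
  root : Growth 0
  leaf : Growth n → Fin (suc n) → Growth (suc n)

-- The most recently added vertex is zero, so the parent of a vertex is larger than it.
GrowthAdj : Growth n → Rel (Fin (suc n)) 0ℓ
GrowthAdj root       _       _       = ⊥
GrowthAdj (leaf t p) zero    zero    = ⊥
GrowthAdj (leaf t p) zero    (suc j) = j ≡ p
GrowthAdj (leaf t p) (suc i) zero    = i ≡ p
GrowthAdj (leaf t p) (suc i) (suc j) = GrowthAdj t i j

growthAdj? : (t : Growth n) → Decidable (GrowthAdj t)
growthAdj? root       _       _       = no λ ()
growthAdj? (leaf t p) zero    zero    = no λ ()
growthAdj? (leaf t p) zero    (suc j) = j F.≟ p
growthAdj? (leaf t p) (suc i) zero    = i F.≟ p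
growthAdj? (leaf t p) (suc i) (suc j) = growthAdj? t i j

growthAdj-sym : (t : Growth n) → Symmetric (GrowthAdj t)
growthAdj-sym (leaf t p) {zero}  {suc j} e = e
growthAdj-sym (leaf t p) {suc i} {zero}  e = e
growthAdj-sym (leaf t p) {suc i} {suc j} e = growthAdj-sym t e

growthAdj-irrefl : (t : Growth n) {v : Fin (suc n)} → ¬ GrowthAdj t v v
growthAdj-irrefl (leaf t p) {suc v} e = growthAdj-irrefl t e

growthGraph : Growth n → Graph
growthGraph {n} t = record
  { order  = suc n
  ; Adj    = GrowthAdj t
  ; adj?   = growthAdj? t
  ; symm   = growthAdj-sym t
  ; irrefl = growthAdj-irrefl t
  }

growth-connected : (t : Growth n) → Connected (growthGraph t)
growth-connected t = s≤s z≤n , walk t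
  where
  walk : (t : Growth n) → ∀ u v → Star (GrowthAdj t) u v
  walk root       zero    zero    = ε
  walk (leaf t p) zero    zero    = ε
  walk (leaf t p) zero    (suc j) = refl ◅ gmap suc id (walk t p j)
  walk (leaf t p) (suc i) zero    = gmap suc id (walk t i p) ◅◅ (refl ◅ ε)
  walk (leaf t p) (suc i) (suc j) = gmap suc id (walk t i j)

-- Predecessor and successor along the cycle are distinct because the length is at least three; the
-- closing edge supplies the missing one at the two ends of the vertex list.
cycle-neighbours : ∀ {G} (c : Cycle G k) (let open Cycle c) (i : Fin (3 + k)) →
  ∃[ j ] ∃[ l ] (j ≢ l × Graph.Adj G (vertex i) (vertex j) × Graph.Adj G (vertex i) (vertex l))
cycle-neighbours {k} {G} c i with view i
... | ‵fromℕ =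
  inject₁ (fromℕ (suc k)) , zero , (λ ()) , Graph.symm G (Cycle.step c (fromℕ (suc k))) , Cycle.close c
... | ‵inject₁ zero = suc zero , fromℕ (2 + k) , (λ ()) , Cycle.step c zero , Graph.symm G (Cycle.close c)
... | ‵inject₁ (suc i′) =
  inject₁ (inject₁ i′) , suc (suc i′) , distinct , Graph.symm G (Cycle.step c (inject₁ i′)) , Cycle.step c (suc i′)
  where
  distinct : inject₁ (inject₁ i′) ≢ suc (suc i′)
  distinct eq = ℕP.m≢1+n+m (toℕ i′) {1}
    (trans (sym (trans (toℕ-inject₁ (inject₁ i′)) (toℕ-inject₁ i′))) (cong toℕ eq))

≢zero⇒suc : (x : Fin (suc n)) → x ≢ zero → ∃[ y ] x ≡ suc y
≢zero⇒suc zero    x≢0 = contradiction refl x≢0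
≢zero⇒suc (suc y) _   = y , refl

leaf-neighbour : {t : Growth n} {p : Fin (suc n)} {x : Fin (2 + n)} → GrowthAdj (leaf t p) zero x → x ≡ suc p
leaf-neighbour {x = suc _} refl = refl

-- Both cycle neighbours of a leaf would be its parent, so no cycle passes through the newest leaf,
-- and a cycle avoiding it lies in the smaller tree.
growth-acyclic : (t : Growth n) → Acyclic (growthGraph t)
growth-acyclic root k c = Cycle.close c
growth-acyclic (leaf t p) k c with any? (λ i → Cycle.vertex c i F.≟ zero)
... | yes (i , i-zero) =
  let j , l , j≢l , ij , il = cycle-neighbours c i in
  j≢l (Cycle.injective c (trans (toParent ij) (sym (toParent il))))
  where
  toParent : ∀ {j} → GrowthAdj (leaf t p) (Cycle.vertex c i) (Cycle.vertex c j) → Cycle.vertex c j ≡ suc p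
  toParent {j} e = leaf-neighbour {t = t} (subst (λ x → GrowthAdj (leaf t p) x (Cycle.vertex c j)) i-zero e)
... | no no-zero = growth-acyclic t k record
  { vertex    = λ i → proj₁ (old i)
  ; injective = λ {i} {j} eq → Cycle.injective c
      (trans (proj₂ (old i)) (trans (cong suc eq) (sym (proj₂ (old j)))))
  ; step      = λ i → subst₂ (GrowthAdj (leaf t p))
      (proj₂ (old (inject₁ i))) (proj₂ (old (suc i))) (Cycle.step c i)
  ; close     = subst₂ (GrowthAdj (leaf t p))
      (proj₂ (old (fromℕ (2 + k)))) (proj₂ (old zero)) (Cycle.close c)
  }
  where
  old : ∀ i → ∃[ y ] Cycle.vertex c i ≡ suc y
  old i = ≢zero⇒suc (Cycle.vertex c i) (λ eq → no-zero (i , eq))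

allPairs-lookup : ∀ {a ℓ} {A : Set a} {R : Rel A ℓ} {xs : List A} → AllPairs R xs →
  ∀ {i j} → i F.< j → R (lookup xs i) (lookup xs j)
allPairs-lookup {xs = _ ∷ xs} (px ∷ _) {zero}  {suc j} _         = All.lookup px (∈-lookup {xs = xs} j)
allPairs-lookup (_ ∷ pxs)              {suc i} {suc j} (s<s i<j) = allPairs-lookup pxs i<j

-- Every edge is counted at its smaller endpoint.
size≤order : (G : Graph) → (∀ {u v w} → u F.< v → u F.< w → Graph.Adj G u v → Graph.Adj G u w → v ≡ w) →
  size G ≤ order G
size≤order G unique = injective⇒≤ {f = proj₁ ∘ lookup es} λ {i} {j} eq → inj i j eq
  where
  open Graph G using (Adj; adj?)
  isEdge? : (e : Vertex G × Vertex G) → Dec (proj₁ e F.< proj₂ e × Adj (proj₁ e) (proj₂ e))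
  isEdge? e = (proj₁ e F.<? proj₂ e) ×-dec adj? (proj₁ e) (proj₂ e)
  pairs es : List (Vertex G × Vertex G)
  pairs = cartesianProduct (allFin (order G)) (allFin (order G))
  es = filter isEdge? pairs
  es-unique : Unique es
  es-unique = Unique.filter⁺ isEdge? (Unique.cartesianProduct⁺ (Unique.allFin⁺ _) (Unique.allFin⁺ _))
  isEdge : ∀ i → proj₁ (lookup es i) F.< proj₂ (lookup es i) ×
    Adj (proj₁ (lookup es i)) (proj₂ (lookup es i))
  isEdge i = All.lookup (all-filter isEdge? pairs) (∈-lookup {xs = es} i)
  same : ∀ i j → proj₁ (lookup es i) ≡ proj₁ (lookup es j) → lookup es i ≡ lookup es j
  same i j eq with lookup es i | lookup es j | isEdge i | isEdge j
  same i j refl | u , v | .u , w | u<v , uv | u<w , uw = cong (u ,_) (unique u<v u<w uv uw)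
  inj : ∀ i j → proj₁ (lookup es i) ≡ proj₁ (lookup es j) → i ≡ j
  inj i j eq with FP.<-cmp i j
  ... | tri< i<j _ _ = contradiction (same i j eq) (allPairs-lookup es-unique i<j)
  ... | tri≈ _ i≡j _ = i≡j
  ... | tri> _ _ j<i = contradiction (same j i (sym eq)) (allPairs-lookup es-unique j<i)

-- The only neighbour of a vertex above it is its parent. Estimating by the order exceeds the true
-- number of edges by one, which only shifts constants.
growth-size : (t : Growth n) → size (growthGraph t) ≤ suc n
growth-size t = size≤order (growthGraph t) (parent-unique t)
  where
  parent-unique : (t : Growth n) → ∀ {u v w} → u F.< v → u F.< w → GrowthAdj t u v → GrowthAdj t u w → v ≡ w
  parent-unique (leaf t p) {zero}  {suc v} {suc w} _         _         e e′ = cong suc (trans e (sym e′))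
  parent-unique (leaf t p) {suc u} {suc v} {suc w} (s<s u<v) (s<s u<w) e e′ =
    cong suc (parent-unique t u<v u<w e e′)

-- Bounded trees covering prescribed vertices

record Cover {n} (R : Rel (Fin n) 0ℓ) (P : Fin n → Set) (k : ℕ) : Set where
  field
    {edges}   : ℕ
    edges≤    : edges ≤ k
    shape     : Growth edges
    map       : Fin (suc edges) → Fin n
    injective : Injective _≡_ _≡_ map
    preserves : ∀ {a b} → GrowthAdj shape a b → R (map a) (map b)
    covers    : ∀ {v} → P v → ∃[ t ] map t ≡ v

module _ {R : Rel (Fin n) 0ℓ} where

  cover-vertex : (u : Fin n) → Cover R (_≡ u) 0
  cover-vertex u = record
    { edges≤    = z≤n
    ; shape     = root
    ; map       = λ _ → u
    ; injective = λ { {zero} {zero} _ → refl }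
    ; preserves = λ ()
    ; covers    = λ eq → zero , sym eq
    }

  cover-⊆ : {P Q : Fin n → Set} → (∀ {v} → Q v → P v) → Cover R P k → Cover R Q k
  cover-⊆ Q⊆P T = record { Cover T ; covers = Cover.covers T ∘ Q⊆P }

  -- A vertex already in the tree is left alone, which is why `edges≤` is only an inequality;
  -- otherwise `v` becomes a new leaf at the tree vertex mapped to `u`.
  extend : Symmetric R → {P : Fin n → Set} → Cover R P k →
    ∀ {u v} → P u → u ≡ v ⊎ R u v → Cover R (λ w → P w ⊎ w ≡ v) (suc k)
  extend R-sym T {v = v} Pu uv with any? (λ t → Cover.map T t F.≟ v)
  ... | yes v∈T = record
    { Cover T
    ; edges≤ = ℕP.m≤n⇒m≤1+n (Cover.edges≤ T)
    ; covers = λ { (inj₁ Pw) → Cover.covers T Pw ; (inj₂ refl) → v∈T }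
    }
  extend R-sym T {u} Pu (inj₁ refl) | no v∉T = contradiction (Cover.covers T Pu) v∉T
  extend R-sym T {u} {v} Pu (inj₂ uv) | no v∉T = record
    { edges≤    = s≤s edges≤
    ; shape     = leaf shape (proj₁ (covers Pu))
    ; map       = map⁺
    ; injective = λ {a} {b} → inj a b
    ; preserves = λ {a} {b} → pres a b
    ; covers    = λ { (inj₁ Pw) → let t , eq = covers Pw in suc t , eq
                    ; (inj₂ refl) → zero , refl }
    }
    where
    open Cover T
    map⁺ : Fin (2 + edges) → Fin n
    map⁺ zero    = v
    map⁺ (suc t) = map t
    inj : ∀ a b → map⁺ a ≡ map⁺ b → a ≡ b
    inj zero    zero    _  = refl
    inj zero    (suc b) eq = contradiction (b , sym eq) v∉T
    inj (suc a) zero    eq = contradiction (a , eq) v∉T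
    inj (suc a) (suc b) eq = cong suc (injective eq)
    parent : R (map (proj₁ (covers Pu))) v
    parent = subst (λ w → R w v) (sym (proj₂ (covers Pu))) uv
    pres : ∀ a b → GrowthAdj (leaf shape (proj₁ (covers Pu))) a b → R (map⁺ a) (map⁺ b)
    pres zero    (suc _) refl = R-sym parent
    pres (suc _) zero    refl = parent
    pres (suc _) (suc _) e    = preserves e

-- Membership of the tree edges in `R` is returned along with the tree: taking for `R` a set of
-- differently coloured edges makes the tree rainbow.
cover⇒STree : ∀ {G} {R : Rel (Vertex G) 0ℓ} {P S} → (∀ {u v} → R u v → Graph.Adj G u v) →
  Cover R P k → (∀ {v} → v ∈ S → P v) →
  Σ[ T ∈ STree G S ] (size (STree.tree T) ≤ suc k ×
    (∀ {a b} → Graph.Adj (STree.tree T) a b → R (STree.map T a) (STree.map T b)))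
cover⇒STree R⊆Adj T S⊆P =
  record
    { tree      = growthGraph shape
    ; isTree    = growth-connected shape , growth-acyclic shape
    ; embedding = record { map = map ; injective = injective ; preserves = R⊆Adj ∘ preserves }
    ; covers    = covers ∘ S⊆P
    } ,
  ≤-trans (growth-size shape) (s≤s edges≤) ,
  preserves
  where open Cover T

-- Colourings given by functions on vertex pairs

SameEdge : {A : Set} → A → A → A → A → Set
SameEdge u v u′ v′ = (u ≡ u′ × v ≡ v′) ⊎ (u ≡ v′ × v ≡ u′)

-- A canonical orientation of an unordered pair, so that colours defined from it are symmetric.
sortPair : Fin n → Fin n → Fin n × Fin n
sortPair u v with u F.≤? v
... | yes _ = u , v
... | no  _ = v , u

sortPair-comm : (u v : Fin n) → sortPair u v ≡ sortPair v u
sortPair-comm u v with u F.≤? v | v F.≤? u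
... | yes u≤v | yes v≤u = cong₂ _,_ (FP.≤-antisym u≤v v≤u) (FP.≤-antisym v≤u u≤v)
... | yes _   | no  _   = refl
... | no  _   | yes _   = refl
... | no  u≰v | no  v≰u = contradiction (<⇒≤ (≰⇒> u≰v)) v≰u

sortPair-spec : (u v : Fin n) → sortPair u v ≡ (u , v) ⊎ sortPair u v ≡ (v , u)
sortPair-spec u v with u F.≤? v
... | yes _ = inj₁ refl
... | no  _ = inj₂ refl

sortPair-injective : (u v u′ v′ : Fin n) → sortPair u v ≡ sortPair u′ v′ → SameEdge u v u′ v′
sortPair-injective u v u′ v′ eq with sortPair-spec u v | sortPair-spec u′ v′
... | inj₁ p | inj₁ q with trans (sym p) (trans eq q)
...   | refl = inj₁ (refl , refl)
sortPair-injective u v u′ v′ eq | inj₁ p | inj₂ q with trans (sym p) (trans eq q)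
...   | refl = inj₂ (refl , refl)
sortPair-injective u v u′ v′ eq | inj₂ p | inj₁ q with trans (sym p) (trans eq q)
...   | refl = inj₂ (refl , refl)
sortPair-injective u v u′ v′ eq | inj₂ p | inj₂ q with trans (sym p) (trans eq q)
...   | refl = inj₁ (refl , refl)

vertexColoring : (G : Graph) (c : Vertex G → Vertex G → Fin m) → (∀ u v → c u v ≡ c v u) → EdgeColoring G m
vertexColoring G c c-comm = record { color = λ {u} {v} _ → c u v ; unoriented = λ {u} {v} _ _ → c-comm u v }

-- It suffices that colours separate the edges of some relation `R` containing the tree; injectivity
-- of the embedding carries equality of edges back to the tree.
injective⇒rainbow : ∀ {G S} (c : EdgeColoring G m) (T : STree G S) (R : Rel (Vertex G) 0ℓ) →
  (∀ {a b} → Graph.Adj (STree.tree T) a b → R (STree.map T a) (STree.map T b)) →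
  (∀ {u v u′ v′} (p : Graph.Adj G u v) (q : Graph.Adj G u′ v′) → R u v → R u′ v′ →
    EdgeColoring.color c p ≡ EdgeColoring.color c q → SameEdge u v u′ v′) →
  IsRainbow c T
injective⇒rainbow c T R T⊆R c-inj p q eq with c-inj _ _ (T⊆R p) (T⊆R q) eq
... | inj₁ (a , b) = inj₁ (STree.injective T a , STree.injective T b)
... | inj₂ (a , b) = inj₂ (STree.injective T a , STree.injective T b)

-- Giving every edge its own colour shows that a 3-rainbow colouring exists as soon as the Steiner
-- trees do, so that the rainbow index is defined.
distinctColoring : (G : Graph) → EdgeColoring G (order G * order G)
distinctColoring G = vertexColoring G
  (λ u v → combine (proj₁ (sortPair u v)) (proj₂ (sortPair u v)))
  (λ u v → cong (λ e → combine (proj₁ e) (proj₂ e)) (sortPair-comm u v))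

distinctColoring-rainbow : ∀ {G S} (T : STree G S) → IsRainbow (distinctColoring G) T
distinctColoring-rainbow {G} T = injective⇒rainbow (distinctColoring G) T (λ _ _ → ⊤) (λ _ → tt)
  λ {u} {v} {u′} {v′} _ _ _ _ eq →
  let eq₁ , eq₂ = combine-injective (proj₁ (sortPair u v)) (proj₂ (sortPair u v))
                                    (proj₁ (sortPair u′ v′)) (proj₂ (sortPair u′ v′)) eq
  in sortPair-injective u v u′ v′ (cong₂ _,_ eq₁ eq₂)

-- Unboundedness from many colours and small Steiner trees

¬¬-minimum : ∀ {ℓ} (P : ℕ → Set ℓ) → P n → ¬ ¬ (∃[ m ] IsMinimum P m)
¬¬-minimum {n} P Pn = go (suc n) n ≤-refl Pn
  where
  go : ∀ b n → n < b → P n → ¬ ¬ (∃[ m ] IsMinimum P m)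
  go (suc b) n (s≤s n≤b) Pn none = none (n , Pn , least)
    where
    least : ∀ i → P i → n ≤ i
    least i Pi with n ℕP.≤? i
    ... | yes n≤i = n≤i
    ... | no  n≰i = ⊥-elim (go b i (<-≤-trans (≰⇒> n≰i) n≤b) Pi none)

-- Climbing from `n`: `d` measures the room left below the bound `B`, and any larger witness reduces
-- it.
¬¬-maximum : ∀ {ℓ} (P : ℕ → Set ℓ) {B} → (∀ i → P i → i ≤ B) → P n → ¬ ¬ (∃[ m ] IsMaximum P m)
¬¬-maximum {n} P {B} bounded Pn = go B n (m≤n+m B n) Pn
  where
  go : ∀ d n → B ≤ n + d → P n → ¬ ¬ (∃[ m ] IsMaximum P m)
  go d n B≤n+d Pn none = none (n , Pn , greatest d B≤n+d)
    where
    greatest : ∀ d → B ≤ n + d → ∀ i → P i → i ≤ n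
    greatest zero    B≤ i Pi = ≤-trans (bounded i Pi) (subst (B ≤_) (ℕP.+-identityʳ n) B≤)
    greatest (suc d) B≤ i Pi with i ℕP.≤? n
    ... | yes i≤n = i≤n
    ... | no  i≰n = ⊥-elim (go d i
      (≤-trans (subst (B ≤_) (ℕP.+-suc n d) B≤) (ℕP.+-monoˡ-≤ d (≰⇒> i≰n))) Pi none)

Bounded : ℕ → Graph → Set₁
Bounded C G = ∀ rx sdiam → IsRainbowIndex 3 G rx → IsSteinerDiameter 3 G sdiam → rx ≤ sdiam + C

-- `rx` is at least `A` and `sdiam` at most `B`. Their existence is obtained only up to double
-- negation, which suffices because the conclusion is a negation.
unbounded : (G : Graph) {A B C : ℕ} → 3 ≤ order G →
  (∀ S → ∣ S ∣ ≡ 3 → Σ[ T ∈ STree G S ] size (STree.tree T) ≤ B) →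
  (∀ {m} (c : EdgeColoring G m) → IsRainbowColoring 3 c → A ≤ m) →
  B + C < A →
  ¬ Bounded C G
unbounded G {A} {B} {C} 3≤n trees colors B+C<A bound =
  ¬¬-minimum _ (distinctColoring G , λ S ∣S∣≡3 →
    let T , _ = trees S ∣S∣≡3 in T , λ {_} {_} {_} {_} → distinctColoring-rainbow T)
  λ (rx , isRx) →
  ¬¬-minimum _ (proj₁ (trees S₀ ∣S₀∣≡3) , refl)
  λ (d , isD) →
  ¬¬-maximum _ diam≤B (S₀ , ∣S₀∣≡3 , isD)
  λ (sdiam , isSdiam) →
  <-irrefl refl (begin-strict
    rx        ≤⟨ bound rx sdiam isRx isSdiam ⟩
    sdiam + C ≤⟨ ℕP.+-monoˡ-≤ C (diam≤B sdiam (proj₁ isSdiam)) ⟩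
    B + C     <⟨ B+C<A ⟩
    A         ≤⟨ colors (proj₁ (proj₁ isRx)) (proj₂ (proj₁ isRx)) ⟩
    rx        ∎)
  where
  open ℕP.≤-Reasoning
  -- The first three vertices show that the maximum defining `sdiam` ranges over a nonempty set.
  set₀ : Σ[ S ∈ Subset (order G) ] (∣ S ∣ ≡ 3 × _)
  set₀ = image (λ i → inject≤ i 3≤n) (λ {i} {j} → inject≤-injective 3≤n 3≤n i j)
  S₀ = proj₁ set₀
  ∣S₀∣≡3 = proj₁ (proj₂ set₀)
  diam≤B : ∀ d → Σ[ S ∈ Subset (order G) ] (∣ S ∣ ≡ 3 × IsSteinerDistance G S d) → d ≤ B
  diam≤B d (S , ∣S∣≡3 , _ , least) = let T , T≤B = trees S ∣S∣≡3 in ≤-trans (least _ (T , refl)) T≤B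

-- Edges of a rainbow tree

HasEdge : ∀ {G S} → STree G S → Vertex G → Vertex G → Set
HasEdge T u v = ∃[ a ] ∃[ b ] (Graph.Adj (STree.tree T) a b × STree.map T a ≡ u × STree.map T b ≡ v)

-- Both colours are compared with that of one reversed edge.
color-≡ : ∀ {G} (c : EdgeColoring G m) (let open EdgeColoring c) →
  ∀ {u v} (p q : Graph.Adj G u v) → color p ≡ color q
color-≡ {G = G} c p q =
  trans (EdgeColoring.unoriented c p (Graph.symm G p)) (sym (EdgeColoring.unoriented c q (Graph.symm G p)))

rainbow⇒sameEdge : ∀ {G S} (c : EdgeColoring G m) (T : STree G S) → IsRainbow c T →
  ∀ {u v u′ v′} → HasEdge T u v → HasEdge T u′ v′ →
  (p : Graph.Adj G u v) (q : Graph.Adj G u′ v′) → EdgeColoring.color c p ≡ EdgeColoring.color c q →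
  SameEdge u v u′ v′
rainbow⇒sameEdge c T rainbow (a , b , ab , refl , refl) (a′ , b′ , ab′ , refl , refl) p q eq
  with rainbow ab ab′ (trans (color-≡ c _ p) (trans eq (color-≡ c q _)))
... | inj₁ (refl , refl) = inj₁ (refl , refl)
... | inj₂ (refl , refl) = inj₂ (refl , refl)

triple : {A : Set} → A → A → A → Fin 3 → A
triple x y z 0F = x
triple x y z 1F = y
triple x y z 2F = z

triple-injective : {A : Set} {x y z : A} → x ≢ y → x ≢ z → y ≢ z → Injective _≡_ _≡_ (triple x y z)
triple-injective x≢y x≢z y≢z {0F} {0F} _  = refl
triple-injective x≢y x≢z y≢z {0F} {1F} eq = contradiction eq x≢y
triple-injective x≢y x≢z y≢z {0F} {2F} eq = contradiction eq x≢z
triple-injective x≢y x≢z y≢z {1F} {0F} eq = contradiction (sym eq) x≢y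
triple-injective x≢y x≢z y≢z {1F} {1F} _  = refl
triple-injective x≢y x≢z y≢z {1F} {2F} eq = contradiction eq y≢z
triple-injective x≢y x≢z y≢z {2F} {0F} eq = contradiction (sym eq) x≢z
triple-injective x≢y x≢z y≢z {2F} {1F} eq = contradiction (sym eq) y≢z
triple-injective x≢y x≢z y≢z {2F} {2F} _  = refl

third : 3 ≤ n → (i j : Fin n) → ∃[ l ] (l ≢ i × l ≢ j)
third (s≤s (s≤s (s≤s _))) zero          zero          = 1F , (λ ()) , (λ ())
third (s≤s (s≤s (s≤s _))) zero          (suc zero)    = 2F , (λ ()) , (λ ())
third (s≤s (s≤s (s≤s _))) zero          (suc (suc _)) = 1F , (λ ()) , (λ ())
third (s≤s (s≤s (s≤s _))) (suc zero)    zero          = 2F , (λ ()) , (λ ())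
third (s≤s (s≤s (s≤s _))) (suc (suc _)) zero          = 1F , (λ ()) , (λ ())
third (s≤s (s≤s (s≤s _))) (suc _)       (suc _)       = 0F , (λ ()) , (λ ())

-- A rainbow tree through two pendant vertices contains both pendant edges.
pendant-colors : ∀ {G t} (p q : Fin t → Vertex G) → 3 ≤ t → Injective _≡_ _≡_ p →
  (∀ i → Graph.Adj G (p i) (q i)) → (∀ i {v} → Graph.Adj G (p i) v → v ≡ q i) → (∀ i j → p i ≢ q j) →
  ∀ {m} (c : EdgeColoring G m) → IsRainbowColoring 3 c → t ≤ m
pendant-colors {G} p q 3≤t p-inj edge pendant p≢q c rainbow =
  injective⇒≤ {f = λ i → EdgeColoring.color c (edge i)} inj
  where
  inj : Injective _≡_ _≡_ (λ i → EdgeColoring.color c (edge i))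
  inj {i} {j} eq with i F.≟ j
  ... | yes i≡j = i≡j
  -- The third vertex completes `S` to three elements; the argument concerns the pendant edges at
  -- `i` and `j`.
  ... | no  i≢j with third 3≤t i j
  ...   | l , l≢i , l≢j
    with image (p ∘ triple i j l) (triple-injective i≢j (≢-sym l≢i) (≢-sym l≢j) ∘ p-inj)
  ...     | S , ∣S∣≡3 , into , _ with rainbow S ∣S∣≡3
  ...       | T , T-rainbow =
    [ p-inj ∘ proj₁ , (λ same → contradiction (proj₁ same) (p≢q i j)) ]
      (rainbow⇒sameEdge c T T-rainbow (uses (into 0F) (into 1F) i≢j) (uses (into 1F) (into 0F) (≢-sym i≢j))
        (edge i) (edge j) eq)
    where
    uses : ∀ {a b} → p a ∈ S → p b ∈ S → a ≢ b → HasEdge T (p a) (q a)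
    uses a∈S b∈S a≢b with STree.covers T a∈S | STree.covers T b∈S
    ... | s , s↦a | t , t↦b with proj₂ (proj₁ (STree.isTree T)) s t
    ...   | ε = contradiction (p-inj (trans (sym s↦a) t↦b)) a≢b
    -- The walk in the tree to another vertex of `S` must leave `p a` through its only edge.
    ...   | _◅_ {j = s′} e _ =
      s , s′ , e , s↦a , pendant _ (subst (λ u → Graph.Adj G u (STree.map T s′)) s↦a (STree.preserves T e))

-- Induced embeddings and isomorphisms

anyVec? : {P : Vec (Fin n) m → Set} → (∀ v → Dec (P v)) → Dec (∃ P)
anyVec? {m = zero}  P? = map′ ([] ,_) (λ { ([] , p) → p }) (P? [])
anyVec? {m = suc m} P? = map′ (λ (x , v , p) → x ∷ v , p) (λ { (x ∷ v , p) → x , v , p })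
  (any? λ x → anyVec? λ v → P? (x ∷ v))

-- All vectors of images are searched. Decidability is what allows a case distinction on which of
-- two graphs embeds.
inducedEmbedding? : ∀ H G → Dec (InducedEmbedding H G)
inducedEmbedding? H G = map′
  (λ (f , inj , ind) → record
    { map       = Vec.lookup f
    ; injective = λ {u} {v} → inj u v
    ; induced   = λ u v → mk⇔ (proj₁ (ind u v)) (proj₂ (ind u v)) })
  (λ e → let open InducedEmbedding e in
    Vec.tabulate map ,
    (λ u v eq → injective (subst₂ _≡_ (lookup∘tabulate map u) (lookup∘tabulate map v) eq)) ,
    λ u v → subst₂ (λ x y → (H.Adj u v → G.Adj x y) × (G.Adj x y → H.Adj u v))
              (sym (lookup∘tabulate map u)) (sym (lookup∘tabulate map v))
              (Equivalence.to (induced u v) , Equivalence.from (induced u v)))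
  (anyVec? λ f →
    (all? λ u → all? λ v → (Vec.lookup f u F.≟ Vec.lookup f v) →-dec (u F.≟ v)) ×-dec
    (all? λ u → all? λ v → let x = Vec.lookup f u ; y = Vec.lookup f v in
      (H.adj? u v →-dec G.adj? x y) ×-dec (G.adj? x y →-dec H.adj? u v)))
  where
  module H = Graph H
  module G = Graph G

surjective⇒≅ : ∀ {H G} (e : InducedEmbedding H G) → (∀ v → ∃[ u ] InducedEmbedding.map e u ≡ v) → G ≅ H
surjective⇒≅ {H} {G} e onto = record
  { bijection = mk↔ₛ′ (proj₁ ∘ onto) map (λ u → injective (proj₂ (onto (map u)))) (proj₂ ∘ onto)
  ; adjacency = λ u v → mk⇔
      (Equivalence.from (induced _ _) ∘ subst₂ (Graph.Adj G) (sym (proj₂ (onto u))) (sym (proj₂ (onto v))))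
      (subst₂ (Graph.Adj G) (proj₂ (onto u)) (proj₂ (onto v)) ∘ Equivalence.to (induced _ _))
  }
  where open InducedEmbedding e

≅-sym : ∀ {G H} → G ≅ H → H ≅ G
≅-sym {G} {H} G≅H = surjective⇒≅
  record
    { map       = to
    ; injective = λ {u} {v} eq → trans (sym (strictlyInverseʳ u)) (trans (cong from eq) (strictlyInverseʳ v))
    ; induced   = _≅_.adjacency G≅H
    }
  λ v → from v , strictlyInverseˡ v
  where open Inverse (_≅_.bijection G≅H)

≅-embeds : ∀ {X H G} → X ≅ H → InducedEmbedding H G → InducedEmbedding X G
≅-embeds X≅H e = record
  { map       = map ∘ to
  ; injective = λ {u} {v} eq →
      trans (sym (strictlyInverseʳ u)) (trans (cong from (injective eq)) (strictlyInverseʳ v))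
  ; induced   = λ u v → mk⇔
      (Equivalence.to (induced _ _) ∘ Equivalence.to (_≅_.adjacency X≅H u v))
      (Equivalence.from (_≅_.adjacency X≅H u v) ∘ Equivalence.from (induced _ _))
  }
  where
  open InducedEmbedding e
  open Inverse (_≅_.bijection X≅H)

-- Each `s i` hangs on a vertex of `P` itself, so the order of attachment is immaterial and each
-- costs at most one edge.
extend-all : ∀ {n k j} {R : Rel (Fin n) 0ℓ} → Symmetric R → {P : Fin n → Set} → Cover R P k →
  (s : Fin j → Fin n) → (∀ i → ∃[ u ] (P u × (u ≡ s i ⊎ R u (s i)))) →
  Cover R (λ w → P w ⊎ ∃[ i ] s i ≡ w) (j + k)
extend-all {j = zero}  R-sym T s near = cover-⊆ (λ { (inj₁ Pw) → Pw ; (inj₂ (() , _)) }) T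
extend-all {j = suc j} R-sym T s near =
  cover-⊆ (λ { (inj₁ Pw) → inj₁ (inj₁ Pw)
             ; (inj₂ (zero , eq)) → inj₂ (sym eq)
             ; (inj₂ (suc i , eq)) → inj₁ (inj₂ (i , eq)) })
    (extend R-sym (extend-all R-sym T (s ∘ suc) (near ∘ suc))
      (inj₁ (proj₁ (proj₂ (near zero)))) (proj₂ (proj₂ (near zero))))

-- Induced paths and claw-freeness

module _ {G : Graph} where
  open Graph G using (Adj; symm; irrefl)

  ≢-adj : ∀ {u v} → Adj u v → u ≢ v
  ≢-adj uv refl = irrefl uv

  step : ∀ {u v} → u ≡ v ⊎ Adj u v → Star Adj u v
  step (inj₁ refl) = ε
  step (inj₂ uv)   = uv ◅ ε

  neighbour : Connected G → 3 ≤ order G → ∀ u → ∃[ v ] Adj u v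
  neighbour (_ , walk) 3≤n u with third 3≤n u u
  ... | w , w≢u , _ with walk u w
  ...   | ε     = contradiction refl w≢u
  ...   | e ◅ _ = _ , e

  -- Symmetry and irreflexivity settle the remaining pairs.
  induced-< : (H : Graph) (f : Vertex H → Vertex G) →
    (∀ {u v} → u F.< v → f u ≢ f v × (Graph.Adj H u v ⇔ Adj (f u) (f v))) → InducedEmbedding H G
  induced-< H f above = record { map = f ; injective = λ {u} {v} → inj u v ; induced = ind }
    where
    inj : ∀ u v → f u ≡ f v → u ≡ v
    inj u v eq with FP.<-cmp u v
    ... | tri< u<v _ _ = contradiction eq (proj₁ (above u<v))
    ... | tri≈ _ u≡v _ = u≡v
    ... | tri> _ _ v<u = contradiction (sym eq) (proj₁ (above v<u))
    ind : ∀ u v → Graph.Adj H u v ⇔ Adj (f u) (f v)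
    ind u v with FP.<-cmp u v
    ... | tri< u<v _ _    = proj₂ (above u<v)
    ... | tri≈ _ refl _   = mk⇔ (⊥-elim ∘ Graph.irrefl H) (⊥-elim ∘ irrefl)
    ... | tri> _ _ v<u    = mk⇔
      (symm ∘ Equivalence.to (proj₂ (above v<u)) ∘ Graph.symm H)
      (Graph.symm H ∘ Equivalence.from (proj₂ (above v<u)) ∘ symm)

  inducedP₃ : ∀ {a b c} → Adj a b → Adj b c → ¬ Adj a c → a ≢ c → InducedEmbedding (Path 3) G
  inducedP₃ {a} {b} {c} ab bc ¬ac a≢c = induced-< (Path 3) (triple a b c) λ {u} {v} → above u v
    where
    above : ∀ u v → u F.< v → triple a b c u ≢ triple a b c v ×
      (Graph.Adj (Path 3) u v ⇔ Adj (triple a b c u) (triple a b c v))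
    above 0F 1F _ = ≢-adj ab , mk⇔ (λ _ → ab) (λ _ → inj₁ refl)
    above 0F 2F _ = a≢c , mk⇔ (λ { (inj₁ ()) ; (inj₂ ()) }) (⊥-elim ∘ ¬ac)
    above 1F 2F _ = ≢-adj bc , mk⇔ (λ _ → bc) (λ _ → inj₁ refl)
    above 1F 1F (s<s ())
    above 2F 1F (s<s ())
    above 2F 2F (s<s (s<s ()))

  quadruple : (a b c d : Vertex G) → Fin 4 → Vertex G
  quadruple a b c d 0F = a
  quadruple a b c d 1F = b
  quadruple a b c d 2F = c
  quadruple a b c d 3F = d

  -- The non-adjacencies already force nonconsecutive vertices apart: `a` equal to `c`, for
  -- instance, would make `a` adjacent to `d`.
  inducedP₄ : ∀ {a b c d} → Adj a b → Adj b c → Adj c d → ¬ Adj a c → ¬ Adj a d → ¬ Adj b d →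
    InducedEmbedding (Path 4) G
  inducedP₄ {a} {b} {c} {d} ab bc cd ¬ac ¬ad ¬bd = induced-< (Path 4) (quadruple a b c d) λ {u} {v} → above u v
    where
    above : ∀ u v → u F.< v → quadruple a b c d u ≢ quadruple a b c d v ×
      (Graph.Adj (Path 4) u v ⇔ Adj (quadruple a b c d u) (quadruple a b c d v))
    above 0F 1F _ = ≢-adj ab , mk⇔ (λ _ → ab) (λ _ → inj₁ refl)
    above 0F 2F _ = (λ { refl → ¬ad cd }) , mk⇔ (λ { (inj₁ ()) ; (inj₂ ()) }) (⊥-elim ∘ ¬ac)
    above 0F 3F _ = (λ { refl → ¬ac (symm cd) }) , mk⇔ (λ { (inj₁ ()) ; (inj₂ ()) }) (⊥-elim ∘ ¬ad)
    above 1F 2F _ = ≢-adj bc , mk⇔ (λ _ → bc) (λ _ → inj₁ refl)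
    above 1F 3F _ = (λ { refl → ¬ad ab }) , mk⇔ (λ { (inj₁ ()) ; (inj₂ ()) }) (⊥-elim ∘ ¬bd)
    above 2F 3F _ = ≢-adj cd , mk⇔ (λ _ → cd) (λ _ → inj₁ refl)
    above 1F 1F (s<s ())
    above 2F 1F (s<s ())
    above 3F 1F (s<s ())
    above 2F 2F (s<s (s<s ()))
    above 3F 2F (s<s (s<s ()))
    above 3F 3F (s<s (s<s (s<s ())))

  -- When `side c` splits the neighbours of every `c` into two cliques, two of any three leaves of
  -- an induced star fall into the same clique and would be adjacent.
  two-cliques⇒claw-free : (side : Vertex G → Vertex G → Fin 2) →
    (∀ {c u v} → Adj c u → Adj c v → side c u ≡ side c v → u ≡ v ⊎ Adj u v) →
    ∀ {r} → 3 ≤ r → Free (StarGraph r) G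
  two-cliques⇒claw-free side clique {r} 3≤r e
    with pigeonhole (s<s (s<s z<s)) (λ i → side (map zero) (map (suc (inject≤ i 3≤r))))
    where open InducedEmbedding e
  ... | i , j , i<j , same with clique (Equivalence.to (induced zero (suc (inject≤ i 3≤r))) tt)
                                       (Equivalence.to (induced zero (suc (inject≤ j 3≤r))) tt) same
    where open InducedEmbedding e
  ...   | inj₁ eq  = FP.<⇒≢ i<j
    (inject≤-injective 3≤r 3≤r i j (FP.suc-injective (InducedEmbedding.injective e eq)))
  ...   | inj₂ adj = Equivalence.from
    (InducedEmbedding.induced e (suc (inject≤ i 3≤r)) (suc (inject≤ j 3≤r))) adj

-- Stars

star-connected : ∀ t → Connected (StarGraph t)
star-connected t = s≤s z≤n , walk
  where
  walk : ∀ u v → Star StarAdj u v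
  walk zero    zero    = ε
  walk zero    (suc _) = tt ◅ ε
  walk (suc _) zero    = tt ◅ ε
  walk (suc u) (suc v) = _◅_ {j = zero} tt (tt ◅ ε)

-- The three vertices hang on the centre: at most three edges, plus one from the crude size
-- estimate.
star-trees : ∀ t S → ∣ S ∣ ≡ 3 → Σ[ T ∈ STree (StarGraph t) S ] size (STree.tree T) ≤ 4
star-trees t S ∣S∣≡3 =
  let s , onto = elements S ∣S∣≡3
      T , T≤4 , _ = cover⇒STree {G = StarGraph t} id
        (extend-all (λ {u} {v} → Graph.symm (StarGraph t) {u} {v}) (cover-vertex zero) s
          (λ i → zero , refl , near (s i)))
        (inj₂ ∘ onto)
  in T , T≤4
  where
  near : (v : Fin (suc t)) → zero ≡ v ⊎ StarAdj zero v
  near zero    = inj₁ refl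
  near (suc _) = inj₂ tt

star-colors : ∀ {t} → 3 ≤ t → ∀ {m} (c : EdgeColoring (StarGraph t) m) → IsRainbowColoring 3 c → t ≤ m
star-colors {t} 3≤t = pendant-colors {StarGraph t} suc (λ _ → zero) 3≤t FP.suc-injective (λ _ → tt)
  (λ { _ {zero} _ → refl }) (λ _ _ ())

star-unbounded : ∀ {t C} → 4 + C < t → ¬ Bounded C (StarGraph t)
star-unbounded {t} {C} 4+C<t = unbounded (StarGraph t) (ℕP.m≤n⇒m≤1+n 3≤t) (star-trees t) (star-colors 3≤t) 4+C<t
  where
  3≤t : 3 ≤ t
  3≤t = ≤-trans (s≤s (s≤s (s≤s z≤n))) 4+C<t

-- One end of an edge of `X` maps to the centre. All other vertices of `X` then map to leaves, hence
-- are adjacent to that vertex and to nothing else; with two leaves `X` would be P₃.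
embeds-in-star⇒star : ∀ {t} (X : Graph) → Connected X → 3 ≤ order X → ¬ (X ≅ Path 3) →
  InducedEmbedding X (StarGraph t) → ∃[ r ] (3 ≤ r × X ≅ StarGraph r)
embeds-in-star⇒star {t} X@record { order = suc r } conn 3≤n X≇P₃ e = r , 3≤r r refl 3≤n , X≅star
  where
  open Graph X using (Adj; irrefl; symm)
  open InducedEmbedding e
  centre : ∃[ c ] map c ≡ zero
  centre with neighbour {X} conn 3≤n zero
  ... | v , uv with map zero in eq₀ | map v in eqᵥ | Equivalence.to (induced zero v) uv
  ...   | zero  | _     | _ = zero , eq₀
  ...   | suc _ | zero  | _ = v , eqᵥ
  c : Fin (suc r)
  c = proj₁ centre
  outer : ∀ i → ∃[ y ] map (punchIn c i) ≡ suc y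
  outer i = ≢zero⇒suc _ λ eq → punchInᵢ≢i c i (injective (trans eq (sym (proj₂ centre))))
  spoke : ∀ i → Adj c (punchIn c i)
  spoke i = Equivalence.from (induced c (punchIn c i))
    (subst₂ StarAdj (sym (proj₂ centre)) (sym (proj₂ (outer i))) tt)
  no-rim : ∀ i j → ¬ Adj (punchIn c i) (punchIn c j)
  no-rim i j adj = subst₂ StarAdj (proj₂ (outer i)) (proj₂ (outer j)) (Equivalence.to (induced _ _) adj)
  f : Fin (suc r) → Fin (suc r)
  f zero    = c
  f (suc i) = punchIn c i
  f-induced : ∀ u v → StarAdj u v ⇔ Adj (f u) (f v)
  f-induced zero    zero    = mk⇔ (λ ()) irrefl
  f-induced zero    (suc j) = mk⇔ (λ _ → spoke j) (λ _ → tt)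
  f-induced (suc i) zero    = mk⇔ (λ _ → symm (spoke i)) (λ _ → tt)
  f-induced (suc i) (suc j) = mk⇔ (λ ()) (no-rim i j)
  f-injective : ∀ u v → f u ≡ f v → u ≡ v
  f-injective zero    zero    _  = refl
  f-injective zero    (suc j) eq = contradiction (sym eq) (punchInᵢ≢i c j)
  f-injective (suc i) zero    eq = contradiction eq (punchInᵢ≢i c i)
  f-injective (suc i) (suc j) eq = cong suc (punchIn-injective c i j eq)
  onto : ∀ v → ∃[ u ] f u ≡ v
  onto v with c F.≟ v
  ... | yes c≡v = zero , c≡v
  ... | no  c≢v = suc (punchOut c≢v) , punchIn-punchOut c≢v
  X≅star : X ≅ StarGraph r
  X≅star = surjective⇒≅ record { map = f ; injective = λ {u} {v} → f-injective u v ; induced = f-induced } onto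
  3≤r : ∀ r′ → r′ ≡ r → 3 ≤ suc r′ → 3 ≤ r′
  3≤r (suc zero) _ (s≤s (s≤s ()))
  3≤r (suc (suc (suc _))) _ _ = s≤s (s≤s (s≤s z≤n))
  3≤r (suc (suc zero)) refl _ = contradiction (surjective⇒≅ P₃↪X onto₃) X≇P₃
    where
    P₃↪X : InducedEmbedding (Path 3) X
    P₃↪X = inducedP₃ (symm (spoke 0F)) (spoke 1F) (no-rim 0F 1F) λ eq → case f-injective 1F 2F eq of λ ()
    onto₃ : ∀ v → ∃[ u ] InducedEmbedding.map P₃↪X u ≡ v
    onto₃ v with onto v
    ... | 0F , eq = 1F , eq
    ... | 1F , eq = 0F , eq
    ... | 2F , eq = 2F , eq

-- Cliques with a pendant edge at every vertex

0F-or-1F : (b : Fin 2) → b ≡ 0F ⊎ b ≡ 1F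
0F-or-1F 0F = inj₁ refl
0F-or-1F 1F = inj₂ refl

module Coronas (t : ℕ) where

  -- A vertex encodes a pair: an index in the clique and a kind, `0F` for the clique vertex and `1F`
  -- for the pendant vertex attached to it.
  idx : Fin (t * 2) → Fin t
  idx v = proj₁ (remQuot 2 v)

  kind : Fin (t * 2) → Fin 2
  kind v = proj₂ (remQuot {t} 2 v)

  core pend : Fin t → Fin (t * 2)
  core i = combine i 0F
  pend i = combine i 1F

  idx-combine : ∀ i b → idx (combine i b) ≡ i
  idx-combine i b = cong proj₁ (FP.remQuot-combine i b)

  kind-combine : ∀ (i : Fin t) b → kind (combine i b) ≡ b
  kind-combine i b = cong proj₂ (FP.remQuot-combine i b)

  corona-ext : ∀ {u v} → idx u ≡ idx v → kind u ≡ kind v → u ≡ v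
  corona-ext {u} {v} i≡ k≡ = trans (sym (FP.combine-remQuot {t} 2 u))
    (trans (cong₂ combine i≡ k≡) (FP.combine-remQuot {t} 2 v))

  CoronaAdj : Rel (Fin (t * 2)) 0ℓ
  CoronaAdj u v = (kind u ≡ 0F × kind v ≡ 0F × idx u ≢ idx v) ⊎ (idx u ≡ idx v × kind u ≢ kind v)

  Corona : Graph
  Corona = record
    { order  = t * 2
    ; Adj    = CoronaAdj
    ; adj?   = λ u v → ((kind u F.≟ 0F) ×-dec (kind v F.≟ 0F) ×-dec ¬? (idx u F.≟ idx v))
                       ⊎-dec ((idx u F.≟ idx v) ×-dec ¬? (kind u F.≟ kind v))
    ; symm   = λ { (inj₁ (u0 , v0 , u≢v)) → inj₁ (v0 , u0 , ≢-sym u≢v)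
                 ; (inj₂ (i≡ , k≢))       → inj₂ (sym i≡ , ≢-sym k≢) }
    ; irrefl = λ { (inj₁ (_ , _ , i≢)) → i≢ refl ; (inj₂ (_ , k≢)) → k≢ refl }
    }

  open Graph (Corona) using (Adj; symm)

  core-near : ∀ v → core (idx v) ≡ v ⊎ Adj (core (idx v)) v
  core-near v with 0F-or-1F (kind v)
  ... | inj₁ v0 = inj₁ (corona-ext (idx-combine _ 0F) (trans (kind-combine (idx v) 0F) (sym v0)))
  ... | inj₂ v1 = inj₂ (inj₂ (idx-combine _ 0F , λ eq →
    case trans (sym (kind-combine (idx v) 0F)) (trans eq v1) of λ ()))

  core-clique : ∀ i j → core i ≡ core j ⊎ Adj (core i) (core j)
  core-clique i j with i F.≟ j
  ... | yes i≡j = inj₁ (cong core i≡j)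
  ... | no  i≢j = inj₂ (inj₁ (kind-combine i 0F , kind-combine j 0F ,
    i≢j ∘ subst₂ _≡_ (idx-combine i 0F) (idx-combine j 0F)))

  corona-walk : ∀ u v → Star Adj u v
  corona-walk u v =
    reverse symm (step {Corona} (core-near u)) ◅◅ step {Corona} (core-clique (idx u) (idx v)) ◅◅
    step {Corona} (core-near v)

  -- From the clique vertex of `s 0F` the clique vertices of all `s i` are attached, then the `s i`
  -- themselves: at most six edges, plus one from the size estimate.
  corona-trees : ∀ S → ∣ S ∣ ≡ 3 → Σ[ T ∈ STree (Corona) S ] size (STree.tree T) ≤ 7
  corona-trees S ∣S∣≡3 =
    let s , onto = elements S ∣S∣≡3
        cores = extend-all symm (cover-vertex (core (idx (s 0F)))) (λ i → core (idx (s i)))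
                  (λ i → core (idx (s 0F)) , refl , core-clique _ _)
        T , T≤7 , _ = cover⇒STree {G = Corona} id
          (extend-all symm cores s (λ i → core (idx (s i)) , inj₂ (i , refl) , core-near (s i))) (inj₂ ∘ onto)
    in T , T≤7

  corona-colors : 3 ≤ t → ∀ {m} (c : EdgeColoring (Corona) m) → IsRainbowColoring 3 c → t ≤ m
  corona-colors 3≤t = pendant-colors {Corona} pend core 3≤t
    (λ {i} {j} → proj₁ ∘ combine-injective i 1F j 1F)
    (λ i → inj₂ (trans (idx-combine i 1F) (sym (idx-combine i 0F)) , λ eq →
      case trans (sym (kind-combine i 1F)) (trans eq (kind-combine i 0F)) of λ ()))
    pendant
    (λ i j eq → case proj₂ (combine-injective i 1F j 0F eq) of λ ())
    where
    pendant : ∀ i {v} → Adj (pend i) v → v ≡ core i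
    pendant i (inj₁ (p0 , _)) = case trans (sym (kind-combine i 1F)) p0 of λ ()
    pendant i {v} (inj₂ (i≡ , k≢)) with 0F-or-1F (kind v)
    ... | inj₁ v0 = corona-ext
      (trans (sym i≡) (trans (idx-combine i 1F) (sym (idx-combine i 0F)))) (trans v0 (sym (kind-combine i 0F)))
    ... | inj₂ v1 = contradiction (trans (kind-combine i 1F) (sym v1)) k≢

  3≤order : 3 ≤ t → 3 ≤ t * 2
  3≤order 3≤t = ≤-trans 3≤t (ℕP.m≤m*n t 2)

  corona-unbounded : ∀ {C} → 7 + C < t → ¬ Bounded C Corona
  corona-unbounded {C} 7+C<t = unbounded Corona (3≤order 3≤t) corona-trees (corona-colors 3≤t) 7+C<t
    where
    3≤t : 3 ≤ t
    3≤t = ≤-trans (s≤s (s≤s (s≤s z≤n))) 7+C<t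

  corona-connected : 3 ≤ t → Connected Corona
  corona-connected 3≤t = ≤-trans (s≤s z≤n) (3≤order 3≤t) , corona-walk

  -- Split neighbours by kind: clique vertices are pairwise adjacent, and a neighbour of kind `1F`
  -- shares the index of `c`, so there is at most one.
  corona-claw-free : ∀ {r} → 3 ≤ r → Free (StarGraph r) (Corona)
  corona-claw-free = two-cliques⇒claw-free (λ _ → kind) clique
    where
    same-pend : ∀ {c u} → Adj c u → kind u ≡ 1F → idx c ≡ idx u
    same-pend (inj₁ (_ , u0 , _)) u1 = case trans (sym u0) u1 of λ ()
    same-pend (inj₂ (i≡ , _))     _  = i≡
    clique : ∀ {c u v} → Adj c u → Adj c v → kind u ≡ kind v → u ≡ v ⊎ Adj u v
    clique {c} {u} {v} cu cv u≡v with 0F-or-1F (kind u) | idx u F.≟ idx v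
    ... | _       | yes i≡ = inj₁ (corona-ext i≡ u≡v)
    ... | inj₁ u0 | no i≢  = inj₂ (inj₁ (u0 , trans (sym u≡v) u0 , i≢))
    ... | inj₂ u1 | no i≢  = contradiction
      (trans (sym (same-pend cu u1)) (same-pend cv (trans (sym u≡v) u1))) i≢

-- Three clique vertices would form a triangle, and a single one leaves at most two vertices. So `Y`
-- is an edge with at most one pendant vertex at each end, and its order and the exclusion of P₃
-- leave only P₄.
embeds-in-corona⇒P₄ : ∀ {t} (Y : Graph) → Connected Y → 3 ≤ order Y → ¬ (Y ≅ Path 3) →
  InducedEmbedding Y (Coronas.Corona t) →
  (∀ {a b c} → Graph.Adj Y a b → Graph.Adj Y b c → Graph.Adj Y a c → ⊥) → Y ≅ Path 4
embeds-in-corona⇒P₄ {t} Y conn 3≤n Y≇P₃ e no-triangle = cases (any? (pendAt? c₁)) (any? (pendAt? c₂))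
  where
  open Graph Y using (Adj; symm)
  open Coronas t using (idx; kind; corona-ext)
  open InducedEmbedding e
  ι : Vertex Y → Fin t
  ι u = idx (map u)
  κ : Vertex Y → Fin 2
  κ u = kind (map u)
  ext : ∀ {u v} → ι u ≡ ι v → κ u ≡ κ v → u ≡ v
  ext i≡ k≡ = injective (corona-ext i≡ k≡)
  -- A pendant vertex of `Y` has a neighbour by connectedness, and this can only be its clique
  -- vertex.
  core-of : ∀ u → ∃[ c ] (κ c ≡ 0F × ι c ≡ ι u)
  core-of u with 0F-or-1F (κ u)
  ... | inj₁ u0 = u , u0 , refl
  ... | inj₂ u1 with neighbour {Y} conn 3≤n u
  ...   | v , uv with Equivalence.to (induced u v) uv | 0F-or-1F (κ v)
  ...     | inj₁ (u0 , _)   | _       = case trans (sym u0) u1 of λ ()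
  ...     | inj₂ (i≡ , k≢) | inj₁ v0 = v , v0 , sym i≡
  ...     | inj₂ (i≡ , k≢) | inj₂ v1 = contradiction (trans u1 (sym v1)) k≢
  clique : ∀ {u v} → κ u ≡ 0F → κ v ≡ 0F → ι u ≢ ι v → Adj u v
  clique u0 v0 i≢ = Equivalence.from (induced _ _) (inj₁ (u0 , v0 , i≢))
  c₁ : Vertex Y
  c₁ = proj₁ (core-of (inject≤ zero 3≤n))
  κc₁ : κ c₁ ≡ 0F
  κc₁ = proj₁ (proj₂ (core-of (inject≤ zero 3≤n)))
  -- If all indices agreed, kinds alone would distinguish the vertices, so there would be at most
  -- two.
  elsewhere : ∃[ z ] ι z ≢ ι c₁
  elsewhere with any? (λ z → ¬? (ι z F.≟ ι c₁))
  ... | yes z = z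
  ... | no none = contradiction
    (injective⇒≤ {f = κ} (λ {u} {v} → ext (trans (all-at u) (sym (all-at v))))) (ℕP.<⇒≱ 3≤n)
    where
    all-at : ∀ u → ι u ≡ ι c₁
    all-at u with ι u F.≟ ι c₁
    ... | yes eq = eq
    ... | no neq = contradiction (u , neq) none
  c₂ : Vertex Y
  c₂ = proj₁ (core-of (proj₁ elsewhere))
  κc₂ : κ c₂ ≡ 0F
  κc₂ = proj₁ (proj₂ (core-of (proj₁ elsewhere)))
  ι₁≢ι₂ : ι c₁ ≢ ι c₂
  ι₁≢ι₂ eq = proj₂ elsewhere (sym (trans eq (proj₂ (proj₂ (core-of (proj₁ elsewhere))))))
  c₁c₂ : Adj c₁ c₂
  c₁c₂ = clique κc₁ κc₂ ι₁≢ι₂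
  PendAt : Vertex Y → Vertex Y → Set
  PendAt c p = κ p ≡ 1F × ι p ≡ ι c
  pendAt? : ∀ c p → Dec (PendAt c p)
  pendAt? c p = (κ p F.≟ 1F) ×-dec (ι p F.≟ ι c)
  at : ∀ {c} u → κ c ≡ 0F → ι u ≡ ι c → u ≡ c ⊎ PendAt c u
  at u c0 i≡ with 0F-or-1F (κ u)
  ... | inj₁ u0 = inj₁ (ext i≡ (trans u0 (sym c0)))
  ... | inj₂ u1 = inj₂ (u1 , i≡)
  -- A third index would yield a third clique vertex, hence a triangle with `c₁` and `c₂`.
  classify : ∀ u → (u ≡ c₁ ⊎ PendAt c₁ u) ⊎ (u ≡ c₂ ⊎ PendAt c₂ u)
  classify u with ι u F.≟ ι c₁ | ι u F.≟ ι c₂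
  ... | yes i≡ | _      = inj₁ (at u κc₁ i≡)
  ... | no _   | yes i≡ = inj₂ (at u κc₂ i≡)
  ... | no i≢₁ | no i≢₂ with core-of u
  ...   | w , w0 , i≡ = ⊥-elim (no-triangle c₁c₂
    (clique κc₂ w0 (λ eq → i≢₂ (sym (trans eq i≡)))) (clique κc₁ w0 (λ eq → i≢₁ (sym (trans eq i≡)))))
  pend-adj : ∀ {c p} → κ c ≡ 0F → PendAt c p → Adj p c
  pend-adj c0 (p1 , i≡) = Equivalence.from (induced _ _) (inj₂ (i≡ , λ eq →
    case trans (sym p1) (trans eq c0) of λ ()))
  pend-far : ∀ {c p v} → PendAt c p → ι c ≢ ι v → ¬ Adj p v
  pend-far (p1 , i≡) c≢v pv with Equivalence.to (induced _ _) pv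
  ... | inj₁ (p0 , _)   = case trans (sym p0) p1 of λ ()
  ... | inj₂ (i≡′ , _) = c≢v (trans (sym i≡) i≡′)
  pend-unique : ∀ {c p q} → PendAt c p → PendAt c q → p ≡ q
  pend-unique (p1 , p≡) (q1 , q≡) = ext (trans p≡ (sym q≡)) (trans p1 (sym q1))
  ≢-pend : ∀ {c p v} → PendAt c p → κ v ≡ 0F → p ≢ v
  ≢-pend (p1 , _) v0 refl = case trans (sym v0) p1 of λ ()
  cases : Dec (∃ (PendAt c₁)) → Dec (∃ (PendAt c₂)) → Y ≅ Path 4
  cases (yes (p₁ , at₁)) (yes (p₂ , at₂)) = surjective⇒≅ P₄↪Y onto
    where
    P₄↪Y : InducedEmbedding (Path 4) Y
    P₄↪Y = inducedP₄ (pend-adj κc₁ at₁) c₁c₂ (symm (pend-adj κc₂ at₂)) (pend-far at₁ ι₁≢ι₂)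
      (pend-far at₁ (λ eq → ι₁≢ι₂ (trans eq (proj₂ at₂)))) (pend-far at₂ (≢-sym ι₁≢ι₂) ∘ symm)
    onto : ∀ v → ∃[ u ] InducedEmbedding.map P₄↪Y u ≡ v
    onto v with classify v
    ... | inj₁ (inj₁ v≡) = 1F , sym v≡
    ... | inj₁ (inj₂ at) = 0F , pend-unique at₁ at
    ... | inj₂ (inj₁ v≡) = 2F , sym v≡
    ... | inj₂ (inj₂ at) = 3F , pend-unique at₂ at
  cases (yes (p₁ , at₁)) (no none) = contradiction (surjective⇒≅ P₃↪Y onto) Y≇P₃
    where
    P₃↪Y : InducedEmbedding (Path 3) Y
    P₃↪Y = inducedP₃ (pend-adj κc₁ at₁) c₁c₂ (pend-far at₁ ι₁≢ι₂) (≢-pend at₁ κc₂)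
    onto : ∀ v → ∃[ u ] InducedEmbedding.map P₃↪Y u ≡ v
    onto v with classify v
    ... | inj₁ (inj₁ v≡) = 1F , sym v≡
    ... | inj₁ (inj₂ at) = 0F , pend-unique at₁ at
    ... | inj₂ (inj₁ v≡) = 2F , sym v≡
    ... | inj₂ (inj₂ at) = contradiction (v , at) none
  cases (no none) (yes (p₂ , at₂)) = contradiction (surjective⇒≅ P₃↪Y onto) Y≇P₃
    where
    P₃↪Y : InducedEmbedding (Path 3) Y
    P₃↪Y = inducedP₃ (pend-adj κc₂ at₂) (symm c₁c₂) (pend-far at₂ (≢-sym ι₁≢ι₂)) (≢-pend at₂ κc₁)
    onto : ∀ v → ∃[ u ] InducedEmbedding.map P₃↪Y u ≡ v
    onto v with classify v
    ... | inj₁ (inj₁ v≡) = 2F , sym v≡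
    ... | inj₁ (inj₂ at) = contradiction (v , at) none
    ... | inj₂ (inj₁ v≡) = 1F , sym v≡
    ... | inj₂ (inj₂ at) = 0F , pend-unique at₂ at
  cases (no none₁) (no none₂) with third 3≤n c₁ c₂
  ... | v , v≢c₁ , v≢c₂ with classify v
  ...   | inj₁ (inj₁ v≡) = contradiction v≡ v≢c₁
  ...   | inj₁ (inj₂ at) = contradiction (v , at) none₁
  ...   | inj₂ (inj₁ v≡) = contradiction v≡ v≢c₂
  ...   | inj₂ (inj₂ at) = contradiction (v , at) none₂

-- Cycles

-- Arc x y z e a: the edge {e , e + 1} of a cycle lies in the arc a cut off by its vertices x < y < z,
-- the last arc passing through zero.
data Arc (x y z e : Fin n) : Fin 3 → Set where
  before : e F.< x → Arc x y z e 2F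
  first  : x F.≤ e → e F.< y → Arc x y z e 0F
  second : y F.≤ e → e F.< z → Arc x y z e 1F
  after  : z F.≤ e → Arc x y z e 2F

Avoids : (x y z e : Fin n) → Fin 3 → Set
Avoids x y z e a = ∃[ a′ ] (Arc x y z e a′ × a′ ≢ a)

-- For each arc, the union of the other two is not rainbow.
record BadCut (f : Fin n → Fin m) : Set where
  field
    {x y z} : Fin n
    x<y     : x F.< y
    y<z     : y F.< z
    mono    : ∀ a → ∃[ i ] ∃[ j ] (i F.< j × f i ≡ f j × Avoids x y z i a × Avoids x y z j a)

Repeat : (f : Fin n → Fin m) → Fin n → Set
Repeat f b = ∃[ a ] (a F.< b × f a ≡ f b)

module _ (f : Fin n → Fin m) where

  -- Cutting at the three equally coloured edges puts each into a different arc.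
  cut-triple : ∀ {i j l} → i F.< j → j F.< l → f i ≡ f j → f j ≡ f l → BadCut f
  cut-triple {i} {j} {l} i<j j<l fij fjl = record
    { x<y = i<j ; y<z = j<l
    ; mono = λ { 0F → j , l , j<l , fjl , (1F , arc-j , λ ()) , (2F , arc-l , λ ())
               ; 1F → i , l , <-trans i<j j<l , trans fij fjl , (0F , arc-i , λ ()) , (2F , arc-l , λ ())
               ; 2F → i , j , i<j , fij , (0F , arc-i , λ ()) , (1F , arc-j , λ ()) } }
    where
    arc-i = first ≤-refl i<j
    arc-j = second ≤-refl j<l
    arc-l = after ≤-refl

  -- Cuts at `i`, `i′` and `j′`: the pair `i`, `j` lies in the first arc and serves unless that arc
  -- is omitted, when `i′`, `j′` lie in the two others.
  cut-disjoint : ∀ {i j i′ j′} → i F.< j → j F.< i′ → i′ F.< j′ → f i ≡ f j → f i′ ≡ f j′ → BadCut f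
  cut-disjoint {i} {j} {i′} {j′} i<j j<i′ i′<j′ fij fij′ = record
    { x<y = <-trans i<j j<i′ ; y<z = i′<j′
    ; mono = λ { 0F → i′ , j′ , i′<j′ , fij′ , (1F , second ≤-refl i′<j′ , λ ()) , (2F , after ≤-refl , λ ())
               ; 1F → i , j , i<j , fij , (0F , arc-i , λ ()) , (0F , arc-j , λ ())
               ; 2F → i , j , i<j , fij , (0F , arc-i , λ ()) , (0F , arc-j , λ ()) } }
    where
    arc-i = first ≤-refl (<-trans i<j j<i′)
    arc-j = first (<⇒≤ i<j) j<i′

  -- Cuts at `i′`, `i` and `j′`: the inner pair lies in the second arc, the outer pair is shared by
  -- the other two.
  cut-nested : ∀ {i j i′ j′} → i′ F.< i → i F.< j → j F.< j′ → f i ≡ f j → f i′ ≡ f j′ → BadCut f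
  cut-nested {i} {j} {i′} {j′} i′<i i<j j<j′ fij fij′ = record
    { x<y = i′<i ; y<z = <-trans i<j j<j′
    ; mono = λ { 0F → i , j , i<j , fij , (1F , arc-i , λ ()) , (1F , arc-j , λ ())
               ; 1F → i′ , j′ , <-trans i′<i (<-trans i<j j<j′) , fij′ ,
                      (0F , first ≤-refl i′<i , λ ()) , (2F , after ≤-refl , λ ())
               ; 2F → i , j , i<j , fij , (1F , arc-i , λ ()) , (1F , arc-j , λ ()) } }
    where
    arc-i = second ≤-refl (<-trans i<j j<j′)
    arc-j = second (<⇒≤ i<j) j<j′

  -- Cuts at `a₁`, `a₃` and `b₂` place the six edges two by two in the arcs, so that each of the
  -- three pairs joins a different two of them.
  cut-crossing : ∀ {a₁ a₂ a₃ b₁ b₂ b₃} → a₁ F.< a₂ → a₂ F.< a₃ → a₃ F.< b₁ → b₁ F.< b₂ → b₂ F.< b₃ →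
    f a₁ ≡ f b₁ → f a₂ ≡ f b₂ → f a₃ ≡ f b₃ → BadCut f
  cut-crossing {a₁} {a₂} {a₃} {b₁} {b₂} {b₃}
    a₁<a₂ a₂<a₃ a₃<b₁ b₁<b₂ b₂<b₃ f₁ f₂ f₃ = record
    { x<y = <-trans a₁<a₂ a₂<a₃ ; y<z = <-trans a₃<b₁ b₁<b₂
    ; mono = λ { 0F → a₃ , b₃ , <-trans a₃<b₁ (<-trans b₁<b₂ b₂<b₃) , f₃ ,
                      (1F , second ≤-refl (<-trans a₃<b₁ b₁<b₂) , λ ()) , (2F , after (<⇒≤ b₂<b₃) , λ ())
               ; 1F → a₂ , b₂ , <-trans a₂<a₃ (<-trans a₃<b₁ b₁<b₂) , f₂ ,
                      (0F , first (<⇒≤ a₁<a₂) a₂<a₃ , λ ()) , (2F , after ≤-refl , λ ())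
               ; 2F → a₁ , b₁ , <-trans a₁<a₂ (<-trans a₂<a₃ a₃<b₁) , f₁ ,
                      (0F , first ≤-refl (<-trans a₁<a₂ a₂<a₃) , λ ()) , (1F , second (<⇒≤ a₃<b₁) b₁<b₂ , λ ()) } }

  -- A left end beyond `b₁` gives disjoint pairs, left ends in the wrong order give nested pairs,
  -- coinciding positions give a triple; otherwise the left ends precede `b₁` in increasing order
  -- and the pairs cross.
  repeats⇒cut : ∀ {b₁ b₂ b₃} → b₁ F.< b₂ → b₂ F.< b₃ → Repeat f b₁ → Repeat f b₂ → Repeat f b₃ → BadCut f
  repeats⇒cut {b₁} {b₂} {b₃} b₁<b₂ b₂<b₃ (a₁ , a₁<b₁ , f₁) (a₂ , a₂<b₂ , f₂) (a₃ , a₃<b₃ , f₃)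
    with FP.<-cmp a₂ b₁ | FP.<-cmp a₃ b₁ | FP.<-cmp a₁ a₂ | FP.<-cmp a₂ a₃
  ... | tri> _ _ b₁<a₂ | _ | _ | _ = cut-disjoint a₁<b₁ b₁<a₂ a₂<b₂ f₁ f₂
  ... | tri≈ _ refl _  | _ | _ | _ = cut-triple a₁<b₁ a₂<b₂ f₁ f₂
  ... | tri< _ _ _ | tri> _ _ b₁<a₃ | _ | _ = cut-disjoint a₁<b₁ b₁<a₃ a₃<b₃ f₁ f₃
  ... | tri< _ _ _ | tri≈ _ refl _  | _ | _ = cut-triple a₁<b₁ a₃<b₃ f₁ f₃
  ... | tri< _ _ _ | tri< _ _ _ | tri≈ _ refl _  | _ = cut-triple a₁<b₁ b₁<b₂ f₁ (trans (sym f₁) f₂)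
  ... | tri< _ _ _ | tri< _ _ _ | tri> _ _ a₂<a₁ | _ = cut-nested a₂<a₁ a₁<b₁ b₁<b₂ f₁ f₂
  ... | tri< _ _ _ | tri< _ _ _ | tri< _ _ _ | tri≈ _ refl _  = cut-triple a₂<b₂ b₂<b₃ f₂ (trans (sym f₂) f₃)
  ... | tri< _ _ _ | tri< _ _ _ | tri< _ _ _ | tri> _ _ a₃<a₂ = cut-nested a₃<a₂ a₂<b₂ b₂<b₃ f₂ f₃
  ... | tri< _ _ _ | tri< a₃<b₁ _ _ | tri< a₁<a₂ _ _ | tri< a₂<a₃ _ _ =
    cut-crossing a₁<a₂ a₂<a₃ a₃<b₁ b₁<b₂ b₂<b₃ f₁ f₂ f₃

sort₃ : {P : Fin n → Set} → ∀ {a b c} → a ≢ b → a ≢ c → b ≢ c → P a → P b → P c →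
  ∃[ x ] ∃[ y ] ∃[ z ] (x F.< y × y F.< z × P x × P y × P z)
sort₃ {a = a} {b} {c} a≢b a≢c b≢c Pa Pb Pc with FP.<-cmp a b | FP.<-cmp b c | FP.<-cmp a c
... | tri≈ _ a≡b _ | _            | _            = contradiction a≡b a≢b
... | _            | tri≈ _ b≡c _ | _            = contradiction b≡c b≢c
... | _            | _            | tri≈ _ a≡c _ = contradiction a≡c a≢c
... | tri< a<b _ _ | tri< b<c _ _ | _            = a , b , c , a<b , b<c , Pa , Pb , Pc
... | tri< a<b _ _ | tri> _ _ c<b | tri< a<c _ _ = a , c , b , a<c , c<b , Pa , Pc , Pb
... | tri< a<b _ _ | tri> _ _ c<b | tri> _ _ c<a = c , a , b , c<a , a<b , Pc , Pa , Pb
... | tri> _ _ b<a | tri< b<c _ _ | tri< a<c _ _ = b , a , c , b<a , a<c , Pb , Pa , Pc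
... | tri> _ _ b<a | tri< b<c _ _ | tri> _ _ c<a = b , c , a , b<c , c<a , Pb , Pc , Pa
... | tri> _ _ b<a | tri> _ _ c<b | _            = c , b , a , c<b , b<a , Pc , Pb , Pa

punchIn-mono-< : ∀ (i : Fin (suc n)) {j l} → j F.< l → punchIn i j F.< punchIn i l
punchIn-mono-< i {j} {l} j<l = FP.≤∧≢⇒< (punchIn-mono-≤ i j l (<⇒≤ j<l)) (FP.<⇒≢ j<l ∘ punchIn-injective i j l)

-- Deleting a repeat leaves more positions than colours as long as three positions are to spare.
few-colors⇒cut : m ≤ n → (f : Fin (3 + n) → Fin m) → BadCut f
few-colors⇒cut {m} {n} m≤n f =
  let b₁ , rep₁ = repeat id id (ℕP.m≤n⇒m≤1+n (ℕP.m≤n⇒m≤1+n (s≤s m≤n)))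
      l₂ , rep₂ = repeat (punchIn b₁) (punchIn-mono-< b₁) (ℕP.m≤n⇒m≤1+n (s≤s m≤n))
      l₃ , rep₃ = repeat (punchIn b₁ ∘ punchIn l₂) (punchIn-mono-< b₁ ∘ punchIn-mono-< l₂) (s≤s m≤n)
      _ , _ , _ , x<y , y<z , rx , ry , rz = sort₃ {P = Repeat f}
        (≢-sym (punchInᵢ≢i b₁ l₂)) (≢-sym (punchInᵢ≢i b₁ (punchIn l₂ l₃)))
        (≢-sym (punchInᵢ≢i l₂ l₃) ∘ punchIn-injective b₁ _ _) rep₁ rep₂ rep₃
  in repeats⇒cut f x<y y<z rx ry rz
  where
  repeat : ∀ {j} (e : Fin j → Fin (3 + n)) → (∀ {a b} → a F.< b → e a F.< e b) → m < j → ∃[ l ] Repeat f (e l)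
  repeat e e-mono m<j = let a , b , a<b , eq = pigeonhole m<j (f ∘ e) in b , e a , e-mono a<b , eq

-- The cycle with vertices 0 to k

module Cycles (k : ℕ) (3≤k : 3 ≤ k) where

  Nextℕ : Rel ℕ 0ℓ
  Nextℕ i j = j ≡ suc i ⊎ (i ≡ k × j ≡ 0)

  Next : Rel (Fin (suc k)) 0ℓ
  Next = Nextℕ on toℕ

  next? : Decidable Next
  next? i j = (toℕ j ℕP.≟ suc (toℕ i)) ⊎-dec ((toℕ i ℕP.≟ k) ×-dec (toℕ j ℕP.≟ 0))

  no-1-cycle : ∀ {a} → ¬ Nextℕ a a
  no-1-cycle (inj₂ (refl , refl)) = case 3≤k of λ ()

  no-2-cycle : ∀ {a b} → Nextℕ a b → ¬ Nextℕ b a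
  no-2-cycle (inj₁ refl)          (inj₂ (refl , refl)) = case 3≤k of λ { (s≤s ()) }
  no-2-cycle (inj₂ (refl , refl)) (inj₁ refl)          = case 3≤k of λ { (s≤s ()) }
  no-2-cycle (inj₂ (refl , refl)) (inj₂ (refl , _))    = case 3≤k of λ ()

  no-3-cycle : ∀ {a b c} → Nextℕ a b → Nextℕ b c → ¬ Nextℕ c a
  no-3-cycle (inj₁ refl)          (inj₁ refl)          (inj₂ (refl , refl)) = case 3≤k of λ { (s≤s (s≤s ())) }
  no-3-cycle (inj₁ refl)          (inj₂ (refl , refl)) (inj₁ refl)          = case 3≤k of λ { (s≤s (s≤s ())) }
  no-3-cycle (inj₁ refl)          (inj₂ (refl , refl)) (inj₂ (() , _))
  no-3-cycle (inj₂ (refl , refl)) (inj₁ refl)          (inj₁ refl)          = case 3≤k of λ { (s≤s (s≤s ())) }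
  no-3-cycle (inj₂ (refl , refl)) (inj₁ refl)          (inj₂ (refl , ()))
  no-3-cycle (inj₂ (refl , refl)) (inj₂ (refl , refl)) _                    = case 3≤k of λ ()

  CycleGraph : Graph
  CycleGraph = record
    { order  = suc k
    ; Adj    = λ i j → Next i j ⊎ Next j i
    ; adj?   = λ i j → next? i j ⊎-dec next? j i
    ; symm   = Data.Sum.swap
    ; irrefl = [ no-1-cycle , no-1-cycle ]
    }

  open Graph CycleGraph using (Adj; symm; irrefl)

  next-functional : ∀ {i j j′} → Next i j → Next i j′ → j ≡ j′
  next-functional         (inj₁ p)       (inj₁ q)       = toℕ-injective (trans p (sym q))
  next-functional {j = j} (inj₁ p)       (inj₂ (q , _)) =
    contradiction (subst (_< suc k) (trans p (cong suc q)) (toℕ<n j)) (<-irrefl refl)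
  next-functional {j′ = j} (inj₂ (q , _)) (inj₁ p) =
    contradiction (subst (_< suc k) (trans p (cong suc q)) (toℕ<n j)) (<-irrefl refl)
  next-functional         (inj₂ (_ , p)) (inj₂ (_ , q)) = toℕ-injective (trans p (sym q))

  next-injective : ∀ {i i′ j} → Next i j → Next i′ j → i ≡ i′
  next-injective (inj₁ p)       (inj₁ q)       = toℕ-injective (ℕP.suc-injective (trans (sym p) q))
  next-injective (inj₁ p)       (inj₂ (_ , q)) = case trans (sym p) q of λ ()
  next-injective (inj₂ (_ , q)) (inj₁ p)       = case trans (sym p) q of λ ()
  next-injective (inj₂ (p , _)) (inj₂ (q , _)) = toℕ-injective (trans p (sym q))

  -- Successor and predecessor are unique, so each side is a single vertex.
  cycle-claw-free : ∀ {r} → 3 ≤ r → Free (StarGraph r) CycleGraph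
  cycle-claw-free = two-cliques⇒claw-free side clique
    where
    side : Fin (suc k) → Fin (suc k) → Fin 2
    side c u with next? c u
    ... | yes _ = 0F
    ... | no  _ = 1F
    clique : ∀ {c u v} → Adj c u → Adj c v → side c u ≡ side c v → u ≡ v ⊎ Adj u v
    clique {c} {u} {v} cu cv eq with next? c u | next? c v
    clique (inj₁ cu) cv        eq | no ¬cu | no _   = contradiction cu ¬cu
    clique (inj₂ uc) (inj₁ cv) eq | no _   | no ¬cv = contradiction cv ¬cv
    clique (inj₂ uc) (inj₂ vc) eq | no _   | no _   = inj₁ (next-injective uc vc)
    clique _         _         eq | yes cu | yes cv = inj₁ (next-functional cu cv)

  -- Orient each edge towards the successor. A triangle is either a directed 3-cycle, impossible in
  -- length at least four, or has two edges leaving or entering the same vertex, whose other ends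
  -- then coincide.
  cycle-triangle-free : ∀ {a b c} → Adj a b → Adj b c → Adj a c → ⊥
  cycle-triangle-free (inj₁ a→b) (inj₁ b→c) (inj₁ a→c) =
    irrefl (subst (λ v → Adj v _) (next-functional a→b a→c) (inj₁ b→c))
  cycle-triangle-free (inj₁ a→b) (inj₁ b→c) (inj₂ c→a) = no-3-cycle a→b b→c c→a
  cycle-triangle-free (inj₁ a→b) (inj₂ c→b) ac = irrefl (subst (Adj _) (sym (next-injective a→b c→b)) ac)
  cycle-triangle-free (inj₂ b→a) (inj₁ b→c) ac = irrefl (subst (Adj _) (sym (next-functional b→a b→c)) ac)
  cycle-triangle-free (inj₂ b→a) (inj₂ c→b) (inj₁ a→c) = no-3-cycle a→c c→b b→a
  cycle-triangle-free (inj₂ b→a) (inj₂ c→b) (inj₂ c→a) =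
    irrefl (subst (λ v → Adj v _) (next-functional c→a c→b) (inj₂ b→a))

  next : Fin (suc k) → Fin (suc k)
  next i with toℕ i ℕP.<? k
  ... | yes i<k = fromℕ< (s≤s i<k)
  ... | no  _   = zero

  next-Next : ∀ i → Next i (next i)
  next-Next i with toℕ i ℕP.<? k
  ... | yes i<k = inj₁ (toℕ-fromℕ< (s≤s i<k))
  ... | no  i≮k = inj₂ (ℕP.≤-antisym (ℕP.≤-pred (toℕ<n i)) (≮⇒≥ i≮k) , refl)

  cycle-connected : Connected CycleGraph
  cycle-connected = s≤s z≤n , λ u v → reverse symm (from-zero u) ◅◅ from-zero v
    where
    reach : ∀ j (j<n : j < suc k) → Star Adj zero (fromℕ< j<n)
    reach zero    _   = ε
    reach (suc j) j<n = reach j (<-trans ≤-refl j<n) ◅◅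
      (inj₁ (inj₁ (trans (toℕ-fromℕ< j<n) (cong suc (sym (toℕ-fromℕ< (<-trans ≤-refl j<n)))))) ◅ ε)
    from-zero : ∀ v → Star Adj zero v
    from-zero v = subst (Star Adj zero) (FP.fromℕ<-toℕ v (toℕ<n v)) (reach (toℕ v) (toℕ<n v))

  cover-prefix : ∀ q → q ≤ k → Cover Adj (λ w → toℕ w ≤ q) q
  cover-prefix zero    _   = cover-⊆ (λ w≤0 → toℕ-injective (ℕP.n≤0⇒n≡0 w≤0)) (cover-vertex zero)
  cover-prefix (suc q) q<k = cover-⊆ split
    (extend symm (cover-prefix q (<⇒≤ q<k)) {u} {v} (≤-reflexive u≡q)
      (inj₂ (inj₁ (inj₁ (trans v≡1+q (cong suc (sym u≡q)))))))
    where
    u v : Fin (suc k)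
    u = fromℕ< (ℕP.m≤n⇒m≤1+n q<k)
    v = fromℕ< (s≤s q<k)
    u≡q : toℕ u ≡ q
    u≡q = toℕ-fromℕ< (ℕP.m≤n⇒m≤1+n q<k)
    v≡1+q : toℕ v ≡ suc q
    v≡1+q = toℕ-fromℕ< (s≤s q<k)
    split : ∀ {w} → toℕ w ≤ suc q → toℕ w ≤ q ⊎ w ≡ v
    split w≤1+q with ℕP.m≤n⇒m<n∨m≡n w≤1+q
    ... | inj₁ (s≤s w≤q) = inj₁ w≤q
    ... | inj₂ w≡1+q     = inj₂ (toℕ-injective (trans w≡1+q (sym v≡1+q)))

  -- The path from 0 to `q` is continued through the closing edge to `k` and then downwards; the
  -- extra 1 counts the closing edge.
  cover-outside : ∀ q d → q ≤ k → d ≤ k → Cover Adj (λ w → toℕ w ≤ q ⊎ k ∸ d ≤ toℕ w) (suc d + q)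
  cover-outside q zero q≤k _ = cover-⊆ split
    (extend symm (cover-prefix q q≤k) {zero} {fromℕ k} z≤n (inj₂ (inj₂ (inj₂ (toℕ-fromℕ k , refl)))))
    where
    split : ∀ {w} → toℕ w ≤ q ⊎ k ≤ toℕ w → toℕ w ≤ q ⊎ w ≡ fromℕ k
    split     (inj₁ w≤q) = inj₁ w≤q
    split {w} (inj₂ k≤w) = inj₂ (toℕ-injective
      (trans (ℕP.≤-antisym (ℕP.≤-pred (toℕ<n w)) k≤w) (sym (toℕ-fromℕ k))))
  cover-outside q (suc d) q≤k d<k = cover-⊆ split
    (extend symm (cover-outside q d q≤k (<⇒≤ d<k)) {u} {v} (inj₂ (≤-reflexive (sym u≡)))
      (inj₂ (inj₂ (inj₁ (trans u≡ (trans (ℕP.+-∸-assoc 1 d<k) (cong suc (sym v≡))))))))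
    where
    u v : Fin (suc k)
    u = fromℕ< (s≤s (ℕP.m∸n≤m k d))
    v = fromℕ< (s≤s (ℕP.m∸n≤m k (suc d)))
    u≡ : toℕ u ≡ k ∸ d
    u≡ = toℕ-fromℕ< (s≤s (ℕP.m∸n≤m k d))
    v≡ : toℕ v ≡ k ∸ suc d
    v≡ = toℕ-fromℕ< (s≤s (ℕP.m∸n≤m k (suc d)))
    split : ∀ {w} → toℕ w ≤ q ⊎ k ∸ suc d ≤ toℕ w → (toℕ w ≤ q ⊎ k ∸ d ≤ toℕ w) ⊎ w ≡ v
    split (inj₁ w≤q) = inj₁ (inj₁ w≤q)
    split {w} (inj₂ w≥) with ℕP.m≤n⇒m<n∨m≡n w≥
    ... | inj₁ w> = inj₁ (inj₂ (subst (_≤ toℕ w) (sym (ℕP.+-∸-assoc 1 d<k)) w>))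
    ... | inj₂ w≡ = inj₂ (toℕ-injective (trans (sym w≡) (sym v≡)))

  -- Cycle edges missed by a tree

  module _ {S} (T : STree CycleGraph S) where

    Uses : Fin (suc k) → Set
    Uses e = HasEdge T e (next e)

    uses? : ∀ e → Dec (Uses e)
    uses? e = any? λ a → any? λ b →
      Graph.adj? (STree.tree T) a b ×-dec (STree.map T a F.≟ e) ×-dec (STree.map T b F.≟ next e)

    -- Two missing edges disconnect the tree.
    module _ {e e′} (¬e : ¬ Uses e) (¬e′ : ¬ Uses e′) where

      Between : Fin (suc k) → Set
      Between v = e F.< v × v F.≤ e′

      -- The segment after `e` up to `e′` can be left forwards only through the edge at `e′`, and
      -- backwards only through the edge at `e`.
      forward : ∀ {u v} → Next u v → u ≢ e′ → Between u → Between v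
      forward (inj₁ v≡1+u) u≢e′ (e<u , u≤e′) =
        subst (toℕ e <_) (sym v≡1+u) (ℕP.m≤n⇒m≤1+n e<u) ,
        subst (_≤ toℕ e′) (sym v≡1+u) (ℕP.≤∧≢⇒< u≤e′ (u≢e′ ∘ toℕ-injective))
      forward (inj₂ (u≡k , _)) u≢e′ (_ , u≤e′) =
        contradiction (toℕ-injective (ℕP.≤-antisym u≤e′ (subst (toℕ e′ ≤_) (sym u≡k) (ℕP.≤-pred (toℕ<n e′))))) u≢e′

      backward : ∀ {u v} → Next u v → u ≢ e → Between v → Between u
      backward (inj₁ v≡1+u) u≢e (e<v , v≤e′) =
        ℕP.≤∧≢⇒< (ℕP.≤-pred (subst (toℕ e <_) v≡1+u e<v)) (u≢e ∘ sym ∘ toℕ-injective) ,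
        <⇒≤ (subst (_≤ toℕ e′) v≡1+u v≤e′)
      backward (inj₂ (_ , v≡0)) _ (e<v , _) = case subst (toℕ e <_) v≡0 e<v of λ ()

      missing : ∀ {a b x} → Graph.Adj (STree.tree T) a b → Next (STree.map T a) (STree.map T b) →
        ¬ Uses x → STree.map T a ≢ x
      missing ab a→b ¬x refl = ¬x (_ , _ , ab , refl , next-functional a→b (next-Next _))

      between-edge : ∀ {a b} → Graph.Adj (STree.tree T) a b → Between (STree.map T a) → Between (STree.map T b)
      between-edge ab with STree.preserves T ab
      ... | inj₁ a→b = forward a→b (missing ab a→b ¬e′)
      ... | inj₂ b→a = backward b→a (missing (Graph.symm (STree.tree T) ab) b→a ¬e)

      between : ∀ {s s′} → s ∈ S → s′ ∈ S → Between s → Between s′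
      between s∈S s′∈S with STree.covers T s∈S | STree.covers T s′∈S
      ... | a , refl | b , refl = walk (proj₂ (proj₁ (STree.isTree T)) a b)
        where
        walk : ∀ {a b} → Star (Graph.Adj (STree.tree T)) a b → Between (STree.map T a) → Between (STree.map T b)
        walk ε        = id
        walk (ab ◅ w) = walk w ∘ between-edge ab

    module _ {x y z} (x<y : x F.< y) (y<z : y F.< z) (x∈S : x ∈ S) (y∈S : y ∈ S) (z∈S : z ∈ S) where

      -- Missing edges in different arcs would separate two of `x`, `y`, `z`, which `between`
      -- excludes. Edges before `x` and after `z` belong to the same arc.
      missing-≤⇒same-arc : ∀ {e e′ a a′} → ¬ Uses e → ¬ Uses e′ → e F.≤ e′ →
        Arc x y z e a → Arc x y z e′ a′ → a ≡ a′
      missing-≤⇒same-arc ¬e ¬e′ e≤e′ arc arc′ with arc | arc′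
      ... | before _ | before _ = refl
      ... | before e<x | first x≤e′ e′<y =
        contradiction (proj₂ (between ¬e ¬e′ x∈S y∈S (e<x , x≤e′))) (ℕP.<⇒≱ e′<y)
      ... | before e<x | second y≤e′ e′<z =
        contradiction (proj₂ (between ¬e ¬e′ x∈S z∈S (e<x , ≤-trans (<⇒≤ x<y) y≤e′))) (ℕP.<⇒≱ e′<z)
      ... | before _ | after _ = refl
      ... | first x≤e _ | before e′<x = contradiction (≤-<-trans e≤e′ e′<x) (ℕP.≤⇒≯ x≤e)
      ... | first _ _ | first _ _ = refl
      ... | first x≤e e<y | second y≤e′ _ =
        contradiction (proj₁ (between ¬e ¬e′ y∈S x∈S (e<y , y≤e′))) (ℕP.≤⇒≯ x≤e)
      ... | first x≤e e<y | after z≤e′ =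
        contradiction (proj₁ (between ¬e ¬e′ y∈S x∈S (e<y , ≤-trans (<⇒≤ y<z) z≤e′))) (ℕP.≤⇒≯ x≤e)
      ... | second y≤e _ | before e′<x = contradiction (≤-<-trans e≤e′ (<-trans e′<x x<y)) (ℕP.≤⇒≯ y≤e)
      ... | second y≤e _ | first _ e′<y = contradiction (≤-<-trans e≤e′ e′<y) (ℕP.≤⇒≯ y≤e)
      ... | second _ _ | second _ _ = refl
      ... | second y≤e e<z | after z≤e′ =
        contradiction (proj₁ (between ¬e ¬e′ z∈S y∈S (e<z , z≤e′))) (ℕP.≤⇒≯ y≤e)
      ... | after _ | before _ = refl
      ... | after z≤e | first _ e′<y = contradiction (≤-<-trans e≤e′ (<-trans e′<y y<z)) (ℕP.≤⇒≯ z≤e)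
      ... | after z≤e | second _ e′<z = contradiction (≤-<-trans e≤e′ e′<z) (ℕP.≤⇒≯ z≤e)
      ... | after _ | after _ = refl

      missing⇒same-arc : ∀ {e e′ a a′} → ¬ Uses e → ¬ Uses e′ →
        Arc x y z e a → Arc x y z e′ a′ → a ≡ a′
      missing⇒same-arc {e} {e′} ¬e ¬e′ arc arc′ with FP.≤-total e e′
      ... | inj₁ e≤e′ = missing-≤⇒same-arc ¬e ¬e′ e≤e′ arc arc′
      ... | inj₂ e′≤e = sym (missing-≤⇒same-arc ¬e′ ¬e e′≤e arc′ arc)

  -- With fewer than n - 2 colours, n being the order, there is a bad cut, and a rainbow tree
  -- through its three vertices misses an edge outside any prescribed arc. Two missing edges in
  -- different arcs are then impossible.
  cycle-colors : (c : EdgeColoring CycleGraph m) → IsRainbowColoring 3 c → k ≤ suc m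
  cycle-colors {m} c rainbow with k ℕP.≤? suc m
  ... | yes k≤1+m = k≤1+m
  ... | no  k≰1+m = ⊥-elim (no-cut (cut k (≰⇒> k≰1+m) color))
    where
    color : Fin (suc k) → Fin m
    color i = EdgeColoring.color c {i} {next i} (inj₁ (next-Next i))
    cut : ∀ k′ → suc m < k′ → (f : Fin (suc k′) → Fin m) → BadCut f
    cut (suc (suc k′)) (s≤s (s≤s m≤k′)) f = few-colors⇒cut m≤k′ f
    no-cut : ¬ BadCut color
    no-cut bad with image (triple x y z) (triple-injective (FP.<⇒≢ x<y) (FP.<⇒≢ (<-trans x<y y<z)) (FP.<⇒≢ y<z))
      where open BadCut bad
    ... | S , ∣S∣≡3 , into , _ with rainbow S ∣S∣≡3
    ...   | T , T-rainbow =
      -- The initial arc `0F` is arbitrary; the second edge is chosen outside the arc of the first.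
      let e , ¬e , a , arc , _       = missing-avoiding 0F
          e′ , ¬e′ , a′ , arc′ , a′≢a = missing-avoiding a
      in a′≢a (missing⇒same-arc T x<y y<z (into 0F) (into 1F) (into 2F) ¬e′ ¬e arc′ arc)
      where
      open BadCut bad
      missing-avoiding : ∀ a → ∃[ e ] (¬ Uses T e × Avoids x y z e a)
      missing-avoiding a with mono a
      ... | i , j , i<j , eq , i-avoids , j-avoids with uses? T i | uses? T j
      ...   | no ¬i | _     = i , ¬i , i-avoids
      ...   | _     | no ¬j = j , ¬j , j-avoids
      ...   | yes i∈T | yes j∈T
        with rainbow⇒sameEdge c T T-rainbow i∈T j∈T (inj₁ (next-Next i)) (inj₁ (next-Next j)) eq
      ...     | inj₁ (i≡j , _)   = contradiction i≡j (FP.<⇒≢ i<j)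
      ...     | inj₂ (i≡j′ , i′≡j) =
        ⊥-elim (no-2-cycle (subst (Next i) i′≡j (next-Next i)) (subst (Next j) (sym i≡j′) (next-Next j)))

-- Blocks of consecutive vertices

missed-value : m < n → (g : Fin m → Fin n) → ∃[ b ] (∀ i → g i ≢ b)
missed-value {m} {n} m<n g with any? (λ b → all? (λ i → ¬? (g i F.≟ b)))
... | yes b   = b
... | no none = contradiction (injective⇒≤ {f = proj₁ ∘ hit} λ {b} {b′} eq →
  trans (sym (proj₂ (hit b))) (trans (cong g eq) (proj₂ (hit b′)))) (ℕP.<⇒≱ m<n)
  where
  hit : ∀ b → ∃[ i ] g i ≡ b
  hit b with any? (λ i → g i F.≟ b)
  ... | yes i = i
  ... | no ¬i = contradiction (b , λ i eq → ¬i (i , eq)) none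

module Blocks {N ℓ : ℕ} where

  block : Fin (N * suc ℓ) → Fin N
  block v = proj₁ (remQuot {N} (suc ℓ) v)

  low high : Fin N → ℕ
  low  b = toℕ (combine b (zero {ℓ}))
  high b = toℕ (combine b (fromℕ ℓ))

  low< : ∀ b → low b < N * suc ℓ
  low< b = toℕ<n (combine b (zero {ℓ}))

  high< : ∀ b → high b < N * suc ℓ
  high< b = toℕ<n (combine b (fromℕ ℓ))

  high≡low+ℓ : ∀ b → high b ≡ low b + ℓ
  high≡low+ℓ b = trans (FP.toℕ-combine b (fromℕ ℓ)) (trans (cong (suc ℓ * toℕ b +_) (toℕ-fromℕ ℓ))
    (cong (_+ ℓ) (sym (trans (FP.toℕ-combine b (zero {ℓ})) (ℕP.+-identityʳ _)))))

  -- The inequalities are weak because the path around the block keeps both end vertices of the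
  -- block and drops only the `ℓ` edges between them.
  outside-block : ∀ b v → block v ≢ b → toℕ v ≤ low b ⊎ high b ≤ toℕ v
  outside-block b v v∉b with FP.<-cmp (block v) b
  ... | tri< lt _ _ = inj₁ (<⇒≤
    (subst (λ w → toℕ w < low b) (FP.combine-remQuot {N} (suc ℓ) v) (combine-monoˡ-< _ zero lt)))
  ... | tri≈ _ eq _ = contradiction eq v∉b
  ... | tri> _ _ gt = inj₂ (<⇒≤
    (subst (λ w → high b < toℕ w) (FP.combine-remQuot {N} (suc ℓ) v) (combine-monoˡ-< (fromℕ ℓ) _ gt)))

-- Of four blocks of consecutive vertices one is disjoint from a given 3-set, and its complement spans a path.
module LongCycles (ℓ : ℕ) where

  -- Chosen so that the order `suc k₀` computes to `4 * suc ℓ`, four blocks of `suc ℓ` vertices.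
  k₀ : ℕ
  k₀ = ℓ + 3 * suc ℓ

  3≤k₀ : 3 ≤ k₀
  3≤k₀ = ≤-trans (ℕP.m≤m*n 3 (suc ℓ)) (m≤n+m (3 * suc ℓ) ℓ)

  open Cycles k₀ 3≤k₀ public

  cover-outside-block : ∀ {q p} → q ≤ k₀ → p ≤ k₀ → p ≡ q + ℓ →
    Cover (Graph.Adj CycleGraph) (λ w → toℕ w ≤ q ⊎ p ≤ toℕ w) (1 + 3 * suc ℓ)
  cover-outside-block {q} {p} q≤k p≤k p≡q+ℓ =
    subst₂ (λ a l → Cover (Graph.Adj CycleGraph) (λ w → toℕ w ≤ q ⊎ a ≤ toℕ w) (suc l))
      (ℕP.m∸[m∸n]≡n p≤k) length≡ (cover-outside q (k₀ ∸ p) q≤k (ℕP.m∸n≤m k₀ p))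
    where
    length≡ : k₀ ∸ p + q ≡ 3 * suc ℓ
    length≡ = ℕP.+-cancelʳ-≡ ℓ _ _ (trans (ℕP.+-assoc (k₀ ∸ p) q ℓ) (trans (cong (k₀ ∸ p +_) (sym p≡q+ℓ))
      (trans (ℕP.m∸n+n≡m p≤k) (ℕP.+-comm ℓ (3 * suc ℓ)))))

  cycle-trees : ∀ S → ∣ S ∣ ≡ 3 → Σ[ T ∈ STree CycleGraph S ] size (STree.tree T) ≤ 2 + 3 * suc ℓ
  cycle-trees S ∣S∣≡3 with elements S ∣S∣≡3
  ... | s , onto with missed-value ≤-refl (Blocks.block {4} {ℓ} ∘ s)
  ...   | b , free =
    let T , T≤ , _ = cover⇒STree {G = CycleGraph} id
          (cover-outside-block (ℕP.≤-pred (Blocks.low< b)) (ℕP.≤-pred (Blocks.high< b)) (Blocks.high≡low+ℓ b))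
          (λ v∈S → let i , eq = onto v∈S in
            subst (λ v → toℕ v ≤ Blocks.low b ⊎ Blocks.high b ≤ toℕ v) eq (Blocks.outside-block b (s i) (free i)))
    in T , T≤

module _ (ℓ : ℕ) where
  open LongCycles (suc ℓ)

  -- At least `ℓ + 3 * (2 + ℓ)` colours are required, one less than `k₀`, while Steiner trees have
  -- size at most `2 + 3 * (2 + ℓ)`; the gap ℓ - 2 exceeds `C`.
  cycle-unbounded : ∀ {C} → 2 + C < ℓ → ¬ Bounded C CycleGraph
  cycle-unbounded {C} 2+C<ℓ = unbounded CycleGraph {A = ℓ + 3 * (2 + ℓ)} (ℕP.m≤n⇒m≤1+n 3≤k₀) cycle-trees
    (λ c rainbow → ℕP.≤-pred (cycle-colors c rainbow))
    (subst (_< ℓ + 3 * (2 + ℓ)) (cong (2 +_) (ℕP.+-comm C (3 * (2 + ℓ)))) (ℕP.+-monoˡ-< (3 * (2 + ℓ)) 2+C<ℓ))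

-- Few colours suffice in connected (K₁,ᵣ, P₄)-free graphs

-- The core consists of a hub, three layers of at most `r` vertices and a middle vertex for each of
-- these. The palette has a colour for every pair of core positions and three more for entering the
-- core.
paletteOf coreSize : ℕ → ℕ
coreSize r = suc ((r + (r + r)) + (r + (r + r)))
paletteOf r = coreSize r * coreSize r + 3

module FewColors (G : Graph) (conn : Connected G) (3≤n : 3 ≤ order G)
  (r : ℕ) (3≤r : 3 ≤ r) (star-free : Free (StarGraph r) G) (P₄-free : Free (Path 4) G) where

  open Graph G using (Adj; adj?; symm)

  V : Set
  V = Vertex G

  open DecMembership (F._≟_ {order G}) using (_∈?_)

  -- A walk is shortened from its end: three consecutive edges without a chord would be an induced
  -- P₄.
  distance≤2 : ∀ u v → u ≡ v ⊎ Adj u v ⊎ ∃[ w ] (Adj u w × Adj w v)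
  distance≤2 u v = shorten (proj₂ conn u v)
    where
    shorten : ∀ {u v} → Star Adj u v → u ≡ v ⊎ Adj u v ⊎ ∃[ w ] (Adj u w × Adj w v)
    shorten ε = inj₁ refl
    shorten {u} {v} (_◅_ {j = a} ua walk) with shorten walk
    ... | inj₁ refl       = inj₂ (inj₁ ua)
    ... | inj₂ (inj₁ av) = inj₂ (inj₂ (a , ua , av))
    ... | inj₂ (inj₂ (b , ab , bv)) with adj? u b | adj? u v | adj? a v
    ...   | yes ub | _      | _      = inj₂ (inj₂ (b , ub , bv))
    ...   | _      | yes uv | _      = inj₂ (inj₁ uv)
    ...   | _      | _      | yes av = inj₂ (inj₂ (a , ua , av))
    ...   | no ¬ub | no ¬uv | no ¬av = contradiction (inducedP₄ ua ab bv ¬ub ¬uv ¬av) P₄-free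

  Independent : Rel V 0ℓ
  Independent u v = u ≢ v × ¬ Adj u v

  -- By induction `w` is adjacent to all but possibly `x`. If it misses `x`, a vertex `z` between
  -- `x` and `y` works: the path `x`, `z`, `y`, `w` must have the chord from `z` to `w`, and then
  -- `x`, `z`, `w`, `v` the chord from `z` to `v`.
  common-neighbour : ∀ x xs → AllPairs Independent (x ∷ xs) → ∃[ w ] All (Adj w) (x ∷ xs)
  common-neighbour x [] _ = let w , xw = neighbour {G} conn 3≤n x in w , symm xw ∷ []
  common-neighbour x (y ∷ ys) (x-ind@((x≢y , ¬xy) ∷ _) ∷ ind) with common-neighbour y ys ind
  ... | w , adj@(wy ∷ _) with adj? w x
  ...   | yes wx = w , wx ∷ adj
  ...   | no ¬wx with distance≤2 x y
  ...     | inj₁ x≡y                     = contradiction x≡y x≢y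
  ...     | inj₂ (inj₁ xy)               = contradiction xy ¬xy
  ...     | inj₂ (inj₂ (z , xz , zy)) =
    z , symm xz ∷ All.zipWith (λ ((_ , ¬xv) , wv) → z-adj ¬xv wv) (x-ind , adj)
    where
    zw : Adj z w
    zw with adj? z w
    ... | yes zw = zw
    ... | no ¬zw = contradiction (inducedP₄ xz zy (symm wy) ¬xy (¬wx ∘ symm) ¬zw) P₄-free
    z-adj : ∀ {v} → ¬ Adj x v → Adj w v → Adj z v
    z-adj {v} ¬xv wv with adj? z v
    ... | yes zv = zv
    ... | no ¬zv = contradiction (inducedP₄ xz zw wv (¬wx ∘ symm) ¬xv ¬zv) P₄-free

  -- Otherwise `r` independent vertices and their common neighbour form an induced star.
  independent<r : ∀ {xs} → AllPairs Independent xs → length xs < r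
  independent<r {xs} ind with r ℕP.≤? length xs
  ... | no  r≰ = ≰⇒> r≰
  independent<r {[]}     ind | yes r≤ = contradiction (≤-trans 3≤r r≤) λ ()
  independent<r {x ∷ xs} ind | yes r≤ = contradiction star star-free
    where
    w : V
    w = proj₁ (common-neighbour x xs ind)
    leaf-at : Fin r → V
    leaf-at i = lookup (x ∷ xs) (inject≤ i r≤)
    f : Fin (suc r) → V
    f zero    = w
    f (suc i) = leaf-at i
    spoke : ∀ i → Adj w (leaf-at i)
    spoke i = All.lookup (proj₂ (common-neighbour x xs ind)) (∈-lookup {xs = x ∷ xs} (inject≤ i r≤))
    above : ∀ u v → u F.< v → f u ≢ f v × (StarAdj u v ⇔ Adj (f u) (f v))
    above zero    (suc j) _         = ≢-adj {G} (spoke j) , mk⇔ (λ _ → spoke j) (λ _ → tt)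
    above (suc i) (suc j) (s<s i<j) =
      let i≢j , ¬ij = allPairs-lookup ind (subst₂ _<_ (sym (FP.toℕ-inject≤ i r≤)) (sym (FP.toℕ-inject≤ j r≤)) i<j)
      in i≢j , mk⇔ (λ ()) ¬ij
    star : InducedEmbedding (StarGraph r) G
    star = induced-< (StarGraph r) f λ {u} {v} → above u v

  -- A maximal independent set among the entries of `xs` outside `L`, with maximality stated as
  -- domination.
  record Maximal (L xs : List V) : Set where
    field
      set         : List V
      independent : AllPairs Independent set
      disjoint    : ∀ {v} → v ∈ˡ set → v ∉ˡ L
      dominating  : ∀ {v} → v ∈ˡ xs → v ∈ˡ L ⊎ v ∈ˡ set ⊎ ∃[ u ] (u ∈ˡ set × Adj v u)

  greedy : ∀ L xs → Maximal L xs
  greedy L [] = record { set = [] ; independent = [] ; disjoint = λ () ; dominating = λ () }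
  greedy L (x ∷ xs) with greedy L xs
  ... | M with x ∈? L | x ∈? Maximal.set M | Any.any? (adj? x) (Maximal.set M)
  ...   | yes x∈L | _ | _ = record
    { Maximal M
    ; dominating = λ { (here refl) → inj₁ x∈L
                     ; (there v∈) → Maximal.dominating M v∈ }
    }
  ...   | _ | yes x∈M | _ = record
    { Maximal M
    ; dominating = λ { (here refl) → inj₂ (inj₁ x∈M)
                     ; (there v∈) → Maximal.dominating M v∈ }
    }
  ...   | _ | _ | yes x~M = record
    { Maximal M
    ; dominating = λ { (here refl) → inj₂ (inj₂ (find x~M))
                     ; (there v∈) → Maximal.dominating M v∈ }
    }
  ...   | no x∉L | no x∉M | no x≁M = record
    { set         = x ∷ set
    ; independent = All.tabulate (λ v∈ → (λ { refl → x∉M v∈ }) , λ xv → x≁M (lose v∈ xv)) ∷ independent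
    ; disjoint    = λ { (here refl) → x∉L ; (there v∈) → disjoint v∈ }
    ; dominating  = λ { (here refl) → inj₂ (inj₁ (here refl)) ; (there v∈) → weaken (dominating v∈) }
    }
    where
    open Maximal M
    weaken : ∀ {v} → v ∈ˡ L ⊎ v ∈ˡ set ⊎ ∃[ u ] (u ∈ˡ set × Adj v u) →
      v ∈ˡ L ⊎ v ∈ˡ (x ∷ set) ⊎ ∃[ u ] (u ∈ˡ (x ∷ set) × Adj v u)
    weaken (inj₁ v∈)                     = inj₁ v∈
    weaken (inj₂ (inj₁ v∈))             = inj₂ (inj₁ (there v∈))
    weaken (inj₂ (inj₂ (u , u∈ , vu))) = inj₂ (inj₂ (u , there u∈ , vu))

  open Maximal

  M₀ : Maximal [] (allFin (order G))
  M₀ = greedy [] (allFin (order G))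

  M₁ : Maximal (set M₀) (allFin (order G))
  M₁ = greedy (set M₀) (allFin (order G))

  M₂ : Maximal (set M₀ ++ set M₁) (allFin (order G))
  M₂ = greedy (set M₀ ++ set M₁) (allFin (order G))

  layer : Fin 3 → List V
  layer = triple (set M₀) (set M₁) (set M₂)

  layers : List V
  layers = set M₀ ++ (set M₁ ++ set M₂)

  layer⊆layers : ∀ i {v} → v ∈ˡ layer i → v ∈ˡ layers
  layer⊆layers 0F v∈ = ∈-++⁺ˡ v∈
  layer⊆layers 1F v∈ = ∈-++⁺ʳ (set M₀) (∈-++⁺ˡ v∈)
  layer⊆layers 2F v∈ = ∈-++⁺ʳ (set M₀) (∈-++⁺ʳ (set M₁) v∈)

  -- Disjointness of the layers makes this the index of the layer; `2F` is also the default
  -- elsewhere.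
  level : V → Fin 3
  level v with v ∈? set M₀ | v ∈? set M₁
  ... | yes _ | _     = 0F
  ... | no  _ | yes _ = 1F
  ... | no  _ | no  _ = 2F

  level-layer : ∀ i {v} → v ∈ˡ layer i → level v ≡ i
  level-layer i {v} v∈ with v ∈? set M₀ | v ∈? set M₁
  level-layer 0F v∈ | yes _  | _      = refl
  level-layer 0F v∈ | no v∉₀ | _      = contradiction v∈ v∉₀
  level-layer 1F v∈ | yes v∈₀ | _     = contradiction v∈₀ (disjoint M₁ v∈)
  level-layer 1F v∈ | no _   | yes _  = refl
  level-layer 1F v∈ | no _   | no v∉₁ = contradiction v∈ v∉₁
  level-layer 2F v∈ | yes v∈₀ | _     = contradiction (∈-++⁺ˡ v∈₀) (disjoint M₂ v∈)
  level-layer 2F v∈ | no _ | yes v∈₁  = contradiction (∈-++⁺ʳ (set M₀) v∈₁) (disjoint M₂ v∈)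
  level-layer 2F v∈ | no _ | no _     = refl

  -- A vertex outside all layers was a candidate for each of them, so maximality gives it a
  -- neighbour in every layer.
  attach : ∀ {v} → v ∉ˡ layers → ∀ i → ∃[ u ] (u ∈ˡ layer i × Adj v u)
  attach {v} v∉ 0F with dominating M₀ (∈-allFin v)
  ... | inj₂ (inj₁ v∈)  = contradiction (layer⊆layers 0F v∈) v∉
  ... | inj₂ (inj₂ u)   = u
  attach {v} v∉ 1F with dominating M₁ (∈-allFin v)
  ... | inj₁ v∈          = contradiction (layer⊆layers 0F v∈) v∉
  ... | inj₂ (inj₁ v∈)  = contradiction (layer⊆layers 1F v∈) v∉
  ... | inj₂ (inj₂ u)   = u
  attach {v} v∉ 2F with dominating M₂ (∈-allFin v)
  ... | inj₁ v∈          = contradiction ([ layer⊆layers 0F , layer⊆layers 1F ] (∈-++⁻ (set M₀) v∈)) v∉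
  ... | inj₂ (inj₁ v∈)  = contradiction (layer⊆layers 2F v∈) v∉
  ... | inj₂ (inj₂ u)   = u

  -- The bounded core

  hub : V
  hub = inject≤ zero 3≤n

  -- Either step may be degenerate, so that all distances up to two take one form.
  link : ∀ v → ∃[ w ] ((hub ≡ w ⊎ Adj hub w) × (w ≡ v ⊎ Adj w v))
  link v with distance≤2 hub v
  ... | inj₁ h≡v                    = hub , inj₁ refl , inj₁ h≡v
  ... | inj₂ (inj₁ hv)              = hub , inj₁ refl , inj₂ hv
  ... | inj₂ (inj₂ (w , hw , wv)) = w , inj₂ hw , inj₂ wv

  mid : V → V
  mid v = proj₁ (link v)

  -- The middle vertices are included so that the paths from the hub to the layers stay inside the
  -- core.
  core : List V
  core = hub ∷ (layers ++ List.map mid layers)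

  layers⊆core : ∀ {v} → v ∈ˡ layers → v ∈ˡ core
  layers⊆core v∈ = there (∈-++⁺ˡ v∈)

  core-link : ∀ {v} → v ∈ˡ core → ∃[ w ] (w ∈ˡ core × (hub ≡ w ⊎ Adj hub w) × (w ≡ v ⊎ Adj w v))
  core-link (here refl) = hub , here refl , inj₁ refl , inj₁ refl
  core-link {v} (there v∈) with ∈-++⁻ layers v∈
  ... | inj₁ v∈D = mid v , there (∈-++⁺ʳ layers (∈-map⁺ mid v∈D)) , proj₂ (link v)
  ... | inj₂ v∈mid with ∈-map⁻ mid v∈mid
  ...   | d , _ , refl = v , there v∈ , proj₁ (proj₂ (link d)) , inj₁ refl

  layers≤ : length layers ≤ r + (r + r)
  layers≤ rewrite length-++ (set M₀) {set M₁ ++ set M₂} | length-++ (set M₁) {set M₂} =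
    ℕP.+-mono-≤ (small M₀) (ℕP.+-mono-≤ (small M₁) (small M₂))
    where
    small : ∀ {L xs} (M : Maximal L xs) → length (set M) ≤ r
    small M = <⇒≤ (independent<r (independent M))

  core≤ : length core ≤ coreSize r
  core≤ rewrite length-++ layers {List.map mid layers} | length-map mid layers = s≤s (ℕP.+-mono-≤ layers≤ layers≤)

  -- The colouring

  pos : V → Fin (coreSize r)
  pos v with v ∈? core
  ... | yes v∈ = inject≤ (Any.index v∈) core≤
  -- Default outside the core, where `pos-injective` makes no claim.
  ... | no  _  = zero

  pos-injective : ∀ {u v} → u ∈ˡ core → v ∈ˡ core → pos u ≡ pos v → u ≡ v
  pos-injective {u} {v} u∈ v∈ eq with u ∈? core | v ∈? core
  ... | no u∉ | _     = contradiction u∈ u∉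
  ... | _     | no v∉ = contradiction v∈ v∉
  ... | yes p | yes q = trans (lookup-index p)
    (trans (cong (lookup core) (inject≤-injective core≤ core≤ (Any.index p) (Any.index q) eq))
      (sym (lookup-index q)))

  coreColor : V → V → Fin (coreSize r * coreSize r)
  coreColor u v = combine (pos (proj₁ (sortPair u v))) (pos (proj₂ (sortPair u v)))

  coreColor-injective : ∀ {u v u′ v′} → u ∈ˡ core → v ∈ˡ core → u′ ∈ˡ core → v′ ∈ˡ core →
    coreColor u v ≡ coreColor u′ v′ → SameEdge u v u′ v′
  coreColor-injective {u} {v} {u′} {v′} u∈ v∈ u′∈ v′∈ eq =
    let eq₁ , eq₂ = combine-injective (pos (proj₁ (sortPair u v))) _ (pos (proj₁ (sortPair u′ v′))) _ eq
        a∈ , b∈ = both u∈ v∈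
        a′∈ , b′∈ = both u′∈ v′∈
    in sortPair-injective u v u′ v′ (cong₂ _,_ (pos-injective a∈ a′∈ eq₁) (pos-injective b∈ b′∈ eq₂))
    where
    both : ∀ {u v} → u ∈ˡ core → v ∈ˡ core → proj₁ (sortPair u v) ∈ˡ core × proj₂ (sortPair u v) ∈ˡ core
    both {u} {v} u∈ v∈ with u F.≤? v
    ... | yes _ = u∈ , v∈
    ... | no  _ = v∈ , u∈

  color : V → V → Fin (paletteOf r)
  color u v with u ∈? core | v ∈? core
  ... | yes _ | yes _ = coreColor u v F.↑ˡ 3
  ... | yes _ | no  _ = (coreSize r * coreSize r) F.↑ʳ level u
  ... | no  _ | yes _ = (coreSize r * coreSize r) F.↑ʳ level v
  -- Edges outside the core share a default colour with the spokes into layer `0F`; the trees chosen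
  -- below avoid them.
  ... | no  _ | no  _ = (coreSize r * coreSize r) F.↑ʳ 0F

  color-comm : ∀ u v → color u v ≡ color v u
  color-comm u v with u ∈? core | v ∈? core
  ... | yes _ | yes _ = cong (λ e → combine (pos (proj₁ e)) (pos (proj₂ e)) F.↑ˡ 3) (sortPair-comm u v)
  ... | yes _ | no  _ = refl
  ... | no  _ | yes _ = refl
  ... | no  _ | no  _ = refl

  color-core : ∀ {u v} → u ∈ˡ core → v ∈ˡ core → color u v ≡ coreColor u v F.↑ˡ 3
  color-core {u} {v} u∈ v∈ with u ∈? core | v ∈? core
  ... | yes _ | yes _ = refl
  ... | no u∉ | _     = contradiction u∈ u∉
  ... | yes _ | no v∉ = contradiction v∈ v∉

  color-spoke : ∀ {u v} → u ∉ˡ core → v ∈ˡ core → color u v ≡ (coreSize r * coreSize r) F.↑ʳ level v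
  color-spoke {u} {v} u∉ v∈ with u ∈? core | v ∈? core
  ... | no _   | yes _ = refl
  ... | yes u∈ | _     = contradiction u∈ u∉
  ... | no _   | no v∉ = contradiction v∈ v∉

  coloring : EdgeColoring G (paletteOf r)
  coloring = vertexColoring G color color-comm

  -- The vertex through which `v` enters the core: a neighbour in layer `i`, or `v` itself if it
  -- already belongs to the core.
  foot : Fin 3 → V → V
  foot i v with v ∈? core
  ... | yes _ = v
  ... | no v∉ = proj₁ (attach (v∉ ∘ layers⊆core) i)

  foot-inside : ∀ i {v} → v ∈ˡ core → foot i v ≡ v
  foot-inside i {v} v∈ with v ∈? core
  ... | yes _ = refl
  ... | no v∉ = contradiction v∈ v∉

  foot-outside : ∀ i {v} → v ∉ˡ core → foot i v ∈ˡ layer i × Adj v (foot i v)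
  foot-outside i {v} v∉ with v ∈? core
  ... | yes v∈ = contradiction v∈ v∉
  ... | no v∉′ = proj₂ (attach (v∉′ ∘ layers⊆core) i)

  foot∈core : ∀ i v → foot i v ∈ˡ core
  foot∈core i v with v ∈? core
  ... | yes v∈ = v∈
  ... | no v∉  = layers⊆core (layer⊆layers i (proj₁ (proj₂ (attach (v∉ ∘ layers⊆core) i))))

  -- The edges inside the core together with, for each i, the edge from s i to its neighbour in layer i.
  module _ (s : Fin 3 → V) where

    Spoke : V → V → Fin 3 → Set
    Spoke u v i = s i ∉ˡ core × SameEdge u v (s i) (foot i (s i))

    Used : Rel V 0ℓ
    Used u v = (u ∈ˡ core × v ∈ˡ core × Adj u v) ⊎ ∃ (Spoke u v)

    used-sym : Symmetric Used
    used-sym (inj₁ (u∈ , v∈ , uv))                 = inj₁ (v∈ , u∈ , symm uv)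
    used-sym (inj₂ (i , out , inj₁ (refl , refl))) = inj₂ (i , out , inj₂ (refl , refl))
    used-sym (inj₂ (i , out , inj₂ (refl , refl))) = inj₂ (i , out , inj₁ (refl , refl))

    used⇒adj : ∀ {u v} → Used u v → Adj u v
    used⇒adj (inj₁ (_ , _ , uv))                   = uv
    used⇒adj (inj₂ (i , out , inj₁ (refl , refl))) = proj₂ (foot-outside i out)
    used⇒adj (inj₂ (i , out , inj₂ (refl , refl))) = symm (proj₂ (foot-outside i out))

    spoke-color : ∀ {u v i} → Spoke u v i → color u v ≡ (coreSize r * coreSize r) F.↑ʳ i
    spoke-color {i = i} (out , inj₁ (refl , refl)) = trans (color-spoke out (foot∈core i (s i)))
      (cong (coreSize r * coreSize r F.↑ʳ_) (level-layer i (proj₁ (foot-outside i out))))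
    spoke-color {i = i} (out , inj₂ (refl , refl)) =
      trans (color-comm (foot i (s i)) (s i)) (spoke-color {i = i} (out , inj₁ (refl , refl)))

    ↑ˡ≢↑ʳ : ∀ {a b} (i : Fin a) (j : Fin b) → i F.↑ˡ b ≢ a F.↑ʳ j
    ↑ˡ≢↑ʳ {a} {b} i j eq =
      case trans (sym (FP.splitAt-↑ˡ a i b)) (trans (cong (F.splitAt a) eq) (FP.splitAt-↑ʳ a b j)) of λ ()

    -- Core edges and spokes draw on separate parts of the palette. A spoke has the colour of its
    -- layer, which determines `i` and therefore the edge.
    used-color-injective : ∀ {u v u′ v′} → Used u v → Used u′ v′ → color u v ≡ color u′ v′ → SameEdge u v u′ v′
    used-color-injective (inj₁ (u∈ , v∈ , _)) (inj₁ (u′∈ , v′∈ , _)) eq =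
      coreColor-injective u∈ v∈ u′∈ v′∈ (FP.↑ˡ-injective 3 _ _
        (trans (sym (color-core u∈ v∈)) (trans eq (color-core u′∈ v′∈))))
    used-color-injective (inj₁ (u∈ , v∈ , _)) (inj₂ (i , sp)) eq =
      contradiction (trans (sym (color-core u∈ v∈)) (trans eq (spoke-color sp))) (↑ˡ≢↑ʳ _ i)
    used-color-injective (inj₂ (i , sp)) (inj₁ (u∈ , v∈ , _)) eq =
      contradiction (trans (sym (color-core u∈ v∈)) (trans (sym eq) (spoke-color sp))) (↑ˡ≢↑ʳ _ i)
    used-color-injective (inj₂ (i , sp)) (inj₂ (j , sp′)) eq
      with FP.↑ʳ-injective (coreSize r * coreSize r) i j
             (trans (sym (spoke-color sp)) (trans eq (spoke-color sp′)))
    used-color-injective (inj₂ (i , _ , inj₁ (refl , refl))) (inj₂ (_ , _ , inj₁ (refl , refl))) _ | refl =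
      inj₁ (refl , refl)
    used-color-injective (inj₂ (i , _ , inj₁ (refl , refl))) (inj₂ (_ , _ , inj₂ (refl , refl))) _ | refl =
      inj₂ (refl , refl)
    used-color-injective (inj₂ (i , _ , inj₂ (refl , refl))) (inj₂ (_ , _ , inj₁ (refl , refl))) _ | refl =
      inj₂ (refl , refl)
    used-color-injective (inj₂ (i , _ , inj₂ (refl , refl))) (inj₂ (_ , _ , inj₂ (refl , refl))) _ | refl =
      inj₁ (refl , refl)

    in-core : ∀ {u v} → u ∈ˡ core → v ∈ˡ core → u ≡ v ⊎ Adj u v → u ≡ v ⊎ Used u v
    in-core u∈ v∈ (inj₁ u≡v) = inj₁ u≡v
    in-core u∈ v∈ (inj₂ uv)  = inj₂ (inj₁ (u∈ , v∈ , uv))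

    foot-near : ∀ i → foot i (s i) ≡ s i ⊎ Used (foot i (s i)) (s i)
    foot-near i = near (s i ∈? core)
      where
      near : Dec (s i ∈ˡ core) → foot i (s i) ≡ s i ⊎ Used (foot i (s i)) (s i)
      near (yes s∈) = inj₁ (foot-inside i s∈)
      near (no s∉)  = inj₂ (inj₂ (i , s∉ , inj₂ (refl , refl)))

    -- The tree grows outwards from the hub in three rounds of three vertices: middle vertices, feet
    -- and the given vertices, hence at most nine edges.
    mids : Cover Used (λ w → w ≡ hub ⊎ ∃[ i ] proj₁ (core-link (foot∈core i (s i))) ≡ w) 3
    mids = extend-all used-sym (cover-vertex hub) _ λ i →
      let w , w∈ , hub-w , _ = core-link (foot∈core i (s i)) in hub , refl , in-core (here refl) w∈ hub-w

    feet : Cover Used (λ w → _ ⊎ ∃[ i ] foot i (s i) ≡ w) 6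
    feet = extend-all used-sym mids (λ i → foot i (s i)) λ i →
      let w , w∈ , _ , w-foot = core-link (foot∈core i (s i))
      in w , inj₂ (i , refl) , in-core w∈ (foot∈core i (s i)) w-foot

    used-cover : Cover Used (λ w → ∃[ i ] s i ≡ w) 9
    used-cover = cover-⊆ inj₂ (extend-all used-sym feet s λ i → foot i (s i) , inj₂ (i , refl) , foot-near i)

    rainbow-tree : ∀ {S} → Cover Used (λ w → ∃[ i ] s i ≡ w) k → (∀ {v} → v ∈ S → ∃[ i ] s i ≡ v) →
      Σ[ T ∈ STree G S ] IsRainbow coloring T
    rainbow-tree cover onto =
      let T , _ , T⊆Used = cover⇒STree {G = G} used⇒adj cover onto
      in T , injective⇒rainbow coloring T Used T⊆Used (λ _ _ → used-color-injective)

  coloring-rainbow : IsRainbowColoring 3 coloring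
  coloring-rainbow S ∣S∣≡3 = let s , onto = elements S ∣S∣≡3 in rainbow-tree s (used-cover s) onto

-- Which forbidden pairs bound the index

Bound : Graph → Graph → ℕ → Set₁
Bound X Y C = (G : Graph) → Connected G → 3 ≤ order G → PairFree X Y G → Bounded C G

≅-free : ∀ {X H G} → X ≅ H → Free X G → Free H G
≅-free X≅H X-free e = X-free (≅-embeds X≅H e)

-- The rainbow index itself is at most the palette size, whatever the Steiner diameter.
few-colors : ∀ {X Y r} → 3 ≤ r → X ≅ StarGraph r → Y ≅ Path 4 → Bound X Y (paletteOf r)
few-colors {r = r} 3≤r X≅star Y≅P₄ G conn 3≤n (X-free , Y-free) rx sdiam (_ , least) _ =
  ≤-trans (least (paletteOf r) (coloring , coloring-rainbow)) (m≤n+m (paletteOf r) sdiam)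
  where open FewColors G conn 3≤n r 3≤r (≅-free X≅star X-free) (≅-free Y≅P₄ Y-free)

module _ {X Y : Graph} {C : ℕ}
  (X-conn : Connected X) (Y-conn : Connected Y) (3≤X : 3 ≤ order X) (3≤Y : 3 ≤ order Y)
  (X≇P₃ : ¬ (X ≅ Path 3)) (Y≇P₃ : ¬ (Y ≅ Path 3)) (bound : Bound X Y C) where

  -- A graph violating the bound is not (X,Y)-free, and decidability of embedding tells which of the
  -- two it contains.
  one-embeds : ∀ G → Connected G → 3 ≤ order G → ¬ Bounded C G → InducedEmbedding X G ⊎ InducedEmbedding Y G
  one-embeds G conn 3≤n G-unbounded with inducedEmbedding? X G | inducedEmbedding? Y G
  ... | yes e | _      = inj₁ e
  ... | _     | yes e  = inj₂ e
  ... | no ¬e | no ¬e′ = contradiction (bound G conn 3≤n (¬e , ¬e′)) G-unbounded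

  embeds-in-some-star : ∀ {t} → 4 + C < t → InducedEmbedding X (StarGraph t) ⊎ InducedEmbedding Y (StarGraph t)
  embeds-in-some-star {t} 4+C<t = one-embeds (StarGraph t) (star-connected t)
    (ℕP.m≤n⇒m≤1+n (≤-trans (s≤s (s≤s (s≤s z≤n))) 4+C<t)) (star-unbounded 4+C<t)

  module _ {r} (3≤r : 3 ≤ r) (X≅star : X ≅ StarGraph r) where

    claw-free⇒Y-embeds : ∀ G → Connected G → 3 ≤ order G → ¬ Bounded C G →
      Free (StarGraph r) G → InducedEmbedding Y G
    claw-free⇒Y-embeds G conn 3≤n G-unbounded claw-free =
      [ (λ e → contradiction e (≅-free (≅-sym X≅star) claw-free)) , id ] (one-embeds G conn 3≤n G-unbounded)

    embeds-in-corona : ∀ {t} → 7 + C < t → InducedEmbedding Y (Coronas.Corona t)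
    embeds-in-corona {t} 7+C<t =
      claw-free⇒Y-embeds Corona (corona-connected 3≤t) (3≤order 3≤t)
        (corona-unbounded 7+C<t) (corona-claw-free 3≤r)
      where
      open Coronas t
      3≤t : 3 ≤ t
      3≤t = ≤-trans (s≤s (s≤s (s≤s z≤n))) 7+C<t

    -- `Y` embeds in a long cycle, which has no triangle.
    triangle-free : ∀ {ℓ} → 2 + C < ℓ → ∀ {a b c} → Graph.Adj Y a b → Graph.Adj Y b c → Graph.Adj Y a c → ⊥
    triangle-free {ℓ} 2+C<ℓ ab bc ac = cycle-triangle-free (adj ab) (adj bc) (adj ac)
      where
      open LongCycles (suc ℓ)
      e : InducedEmbedding Y CycleGraph
      e = claw-free⇒Y-embeds CycleGraph cycle-connected (ℕP.m≤n⇒m≤1+n 3≤k₀)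
        (cycle-unbounded ℓ 2+C<ℓ) (cycle-claw-free 3≤r)
      adj : ∀ {u v} → Graph.Adj Y u v → Graph.Adj CycleGraph (InducedEmbedding.map e u) (InducedEmbedding.map e v)
      adj = Equivalence.to (InducedEmbedding.induced e _ _)

  star-and-P₄ : ∀ {t} → InducedEmbedding X (StarGraph t) → ∃[ r ] (3 ≤ r × X ≅ StarGraph r × Y ≅ Path 4)
  star-and-P₄ e =
    let r , 3≤r , X≅star = embeds-in-star⇒star X X-conn 3≤X X≇P₃ e
    in r , 3≤r , X≅star ,
       embeds-in-corona⇒P₄ Y Y-conn 3≤Y Y≇P₃
         -- The proofs `≤-refl` fix the least admissible parameters: `t` is `8 + C` and `ℓ` is
         -- `3 + C`.
         (embeds-in-corona 3≤r X≅star ≤-refl) (triangle-free 3≤r X≅star ≤-refl)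

Bound-swap : ∀ {X Y C} → Bound X Y C → Bound Y X C
Bound-swap bound G conn 3≤n (Y-free , X-free) = bound G conn 3≤n (X-free , Y-free)

theorem6 : (X Y : Graph) → Connected X → Connected Y →
    3 ≤ order X → 3 ≤ order Y →
    ¬ (X ≅ Path 3) → ¬ (Y ≅ Path 3) →
    (Σ[ C ∈ ℕ ] ((G : Graph) → Connected G → 3 ≤ order G → PairFree X Y G →
        (rx sdiam : ℕ) → IsRainbowIndex 3 G rx → IsSteinerDiameter 3 G sdiam →
        rx ≤ sdiam + C))
    ⇔
    ((∃[ r ] (3 ≤ r × X ≅ StarGraph r × Y ≅ Path 4))
      ⊎ (∃[ r ] (3 ≤ r × Y ≅ StarGraph r × X ≅ Path 4)))
theorem6 X Y X-conn Y-conn 3≤X 3≤Y X≇P₃ Y≇P₃ = mk⇔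
  -- The star with `5 + C` leaves contains `X` or `Y`; the second case is the first with the roles
  -- exchanged.
  (λ (C , bound) → [ inj₁ ∘ star-and-P₄ X-conn Y-conn 3≤X 3≤Y X≇P₃ Y≇P₃ bound
                   , inj₂ ∘ star-and-P₄ Y-conn X-conn 3≤Y 3≤X Y≇P₃ X≇P₃ (Bound-swap bound)
                   ] (embeds-in-some-star X-conn Y-conn 3≤X 3≤Y X≇P₃ Y≇P₃ bound ≤-refl))
  λ { (inj₁ (r , 3≤r , X≅star , Y≅P₄)) → paletteOf r , few-colors 3≤r X≅star Y≅P₄
    ; (inj₂ (r , 3≤r , Y≅star , X≅P₄)) → paletteOf r , Bound-swap (few-colors 3≤r Y≅star X≅P₄) }
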